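{- Let ${\sf Compl}$ be the following formula about a countable bounded partial order $P$ (with top $\top$ and bottom $\bot$), expressing that every element has a complement: $$\forall a\in P\ \exists b\in P\ \forall c\in P\ \ \neg\big[(a,b\le_P c<_P\top)\ \vee\ (\bot<_P c\le_P a,b)\big].$$ Then ${\sf Compl}$ is $\forall\exists\forall$-dicomplete.
   Context: Quantifiers range over $\omega$. $\exists^\infty n\,\varphi(n)$ means $\forall m\exists n\ge m\,\varphi(n)$ and $\forall^\infty n\,\varphi(n)$ means $\exists m\forall n\ge m\,\varphi(n)$. A quantifier-pattern is a finite string $\bar{\mathsf Q}=\mathsf Q_0\dots\mathsf Q_\ell$ over $\{\exists,\forall,\exists^\infty,\forall^\infty\}$. A $\bar{\mathsf Q}$-formula is $\varphi(\bar x)\equiv\mathsf Q_0n_0\dots\mathsf Q_\ell n_\ell\,\theta(n_0,\dots,n_\ell,\bar x)$ with $\theta$ a bounded formula. The instance $\bar x$ is a tuple of natural numbers and/or total computable functions (computable elements of $\omega^\omega$). Spaces such as $\omega\times\omega^\omega$, $(\omega^\omega)^\omega$, $\omega^{\omega\times\omega}$ are identified with $\omega^\omega$ by computable pairing. Witnesses: for $\alpha\in\omega^\omega$, $\alpha\Vdash\varphi(\bar x)$ ("$\alpha$ is a witness for $\varphi(\bar x)$") is defined by: $\alpha\Vdash\theta(\bar x)$ iff $\alpha=\bar x$ and $\theta(\bar x)$, for bounded $\theta$; $\langle t,\alpha\rangle\Vdash\exists n\varphi(n,\bar x)$ iff $\alpha\Vdash\varphi(t,\bar x)$; $\alpha\Vdash\forall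 n\varphi(n,\bar x)$ iff $\alpha(n)\Vdash\varphi(n,\bar x)$ for all $n$; $\langle t,\alpha\rangle\Vdash\forall^\infty n\varphi(n,\bar x)$ iff $\alpha(n)\Vdash\varphi(n,\bar x)$ for all $n\ge t$; $\alpha\Vdash\exists^\infty n\varphi(n,\bar x)$ iff for all $n$, writing $\alpha(n)=\langle k,\beta\rangle$, $k\ge n$ and $\beta\Vdash\varphi(k,\bar x)$. Reducibility: $\varphi\le_{\sf m}\psi$ if there are computable functions $\eta,r_-,r_+$ (type-two computable functionals, possibly partial but defined wherever required) such that for every instance $\bar x$: $\varphi(\bar x)$ is true iff $\psi(\eta(\bar x))$ is true; $\alpha\Vdash\varphi(\bar x)$ implies $r_-(\alpha,\bar x)\Vdash\psi(\eta(\bar x))$; $\alpha\Vdash\psi(\eta(\bar x))$ implies $r_+(\alpha,\bar x)\Vdash\varphi(\bar x)$ ($\alpha\in\omega^\omega$ arbitrary). The dual $\varphi^{\sf d}$ of $\mathsf Q_0n_0\dots\mathsf Q_\ell n_\ell\,\theta$ is $\mathsf Q_0^{\sf d}n_0\dots\mathsf Q_\ell^{\sf d}n_\ell\,\neg\theta$, where $\exists^{\sf d}=\forall$, $\forall^{\sf d}=\exists$, $(\exists^\infty)^{\sf d}=\forall^\infty$, $(\forall^\infty)^{\sf d}=\exists^\infty$. $\varphi\le_{\sf dm}\psi$ if $\varphi\le_{\sf m}\psi$ and $\varphi^{\sf d}\le_{\sf m}\psi^{\sf d}$ via a common $\eta$ (the $r_\pm$ may differ). $\varphi$ is strictly $\bar{\mathsf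 Q}$-dicomplete if it is a $\bar{\mathsf Q}$-formula and $\psi\le_{\sf dm}\varphi$ for every $\bar{\mathsf Q}$-formula $\psi$; it is $\bar{\mathsf Q}$-dicomplete if it is $\equiv_{\sf dm}$-equivalent to a strictly $\bar{\mathsf Q}$-dicomplete formula (one such is $\mathsf Q_0n_0\dots\mathsf Q_\ell n_\ell.\ x(n_0,\dots,n_\ell)=0$). Structures: a countable binary relation $(X,R)$, $X\subseteq\omega$, $R\subseteq X^2$, is coded by the pair of characteristic functions of $X$ and $R$, and is identified with its code; here the instance is a (computable) code of a bounded partial order $P$ together with its elements $\top,\bot$. Reductions from the problem need only work on such instances and reductions to it must output such instances. Restricted quantifiers mean $\forall a(a\in P\to\cdots)$, $\exists b(b\in P\wedge\cdots)$, with these decidable conditions moved into the innermost bounded part. -}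

module Defs where

open import Data.Fin.Base using (Fin)
open import Data.Fin.Patterns using (0F; 1F; 2F; 3F; 4F)
open import Data.List.Base using (List; []; _∷_; map)
open import Data.Nat.Base using (ℕ; zero; suc; _+_; _*_; _≤_; _<_)
open import Data.Product.Base using (Σ-syntax; ∃-syntax; _×_; proj₁; _,_)
open import Data.Sum.Base using (_⊎_)
open import Data.Unit.Base using (⊤)
open import Data.Vec.Base using (Vec; []; _∷_; lookup)
open import Data.Vec.Relation.Binary.Pointwise.Inductive using (Pointwise)
open import Data.Vec.Relation.Unary.All using (All)
open import Function.Base using (_∘_; _on_)
open import Function.Bundles using (_⇔_)
open import Relation.Binary.Definitions using (Maximum; Minimum)
open import Relation.Binary.PropositionalEquality.Core using (_≡_; _≗_)
open import Relation.Binary.Structures using (IsPartialOrder)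
open import Relation.Nullary.Negation.Core using (¬_)

------------------------------------------------------------------------
-- Baire space and its codings

Baire : Set
Baire = ℕ → ℕ

triangle : ℕ → ℕ
triangle zero    = 0
triangle (suc n) = suc n + triangle n

-- Cantor's bijection ℕ × ℕ → ℕ.
pair : ℕ → ℕ → ℕ
pair m n = triangle (m + n) + m

-- ω^ω ≅ ω × ω^ω.
infixr 5 _◂_

_◂_ : ℕ → Baire → Baire
(t ◂ α) zero    = t
(t ◂ α) (suc n) = α n

head : Baire → ℕ
head α = α 0

tail : Baire → Baire
tail α = α ∘ suc

-- ω^ω ≅ (ω^ω)^ω; row α n is what is written α(n) when α is read as a
-- sequence of functions.
row : Baire → ℕ → Baire
row α n m = α (pair n m)

-- ω^ω × ω^ω ≅ ω^ω: f on the even and g on the odd arguments.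
interleave : Baire → Baire → Baire
interleave f g zero    = f 0
interleave f g (suc n) = interleave g (tail f) n

joinFuns : ∀ {q} → Vec Baire q → Baire
joinFuns []           = λ _ → 0
joinFuns (f ∷ [])     = f
joinFuns (f ∷ g ∷ fs) = interleave f (joinFuns (g ∷ fs))

-- Instances: tuples of p numbers and q functions.  Computability of the
-- functions is imposed separately, by IsInstance.
record Tuple (p q : ℕ) : Set where
  constructor tuple
  field
    nums : Vec ℕ p
    funs : Vec Baire q

open Tuple public

infixr 5 _▸_

_▸_ : ∀ {p q} → ℕ → Tuple p q → Tuple (suc p) q
n ▸ tuple ns fs = tuple (n ∷ ns) fs

encode : ∀ {p q} → Tuple p q → Baire
encode (tuple []       fs) = joinFuns fs
encode (tuple (n ∷ ns) fs) = n ◂ encode (tuple ns fs)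

------------------------------------------------------------------------
-- Computability: Kleene's μ-recursive functions relative to q oracles

data Prog (q : ℕ) : ℕ → Set where
  zero   : ∀ {n} → Prog q n
  suc    : Prog q 1
  proj   : ∀ {n} → Fin n → Prog q n
  oracle : Fin q → Prog q 1
  comp   : ∀ {m n} → Prog q m → Vec (Prog q n) m → Prog q n
  prec   : ∀ {n} → Prog q n → Prog q (suc (suc n)) → Prog q (suc n)
  mu     : ∀ {n} → Prog q (suc n) → Prog q n

-- Eval O e xs y: the program e, run with oracles O on input xs, halts with
-- output y.
data Eval {q} (O : Vec Baire q) : ∀ {n} → Prog q n → Vec ℕ n → ℕ → Set where
  zero      : ∀ {n} {xs : Vec ℕ n} → Eval O zero xs 0
  suc       : ∀ {x} → Eval O suc (x ∷ []) (suc x)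
  proj      : ∀ {n} {xs : Vec ℕ n} (i : Fin n) → Eval O (proj i) xs (lookup xs i)
  oracle    : ∀ {x} (i : Fin q) → Eval O (oracle i) (x ∷ []) (lookup O i x)
  comp      : ∀ {m n z} {g : Prog q m} {hs : Vec (Prog q n) m}
              {xs : Vec ℕ n} {ys : Vec ℕ m} →
              Pointwise (λ h y → Eval O h xs y) hs ys →
              Eval O g ys z → Eval O (comp g hs) xs z
  prec-zero : ∀ {n y} {g : Prog q n} {h : Prog q (suc (suc n))} {xs : Vec ℕ n} →
              Eval O g xs y → Eval O (prec g h) (0 ∷ xs) y
  prec-suc  : ∀ {n k y z} {g : Prog q n} {h : Prog q (suc (suc n))} {xs : Vec ℕ n} →
              Eval O (prec g h) (k ∷ xs) y → Eval O h (k ∷ y ∷ xs) z →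
              Eval O (prec g h) (suc k ∷ xs) z
  mu        : ∀ {n k} {f : Prog q (suc n)} {xs : Vec ℕ n} →
              (∀ j → j < k → ∃[ y ] Eval O f (j ∷ xs) (suc y)) →
              Eval O f (k ∷ xs) 0 → Eval O (mu f) xs k

Computes : ∀ {p q} → Prog q (suc p) → Tuple p q → Baire → Set
Computes e x α = ∀ n → Eval (funs x) e (n ∷ nums x) (α n)

Computable : Baire → Set
Computable f = ∃[ e ] Computes e (tuple [] []) f

-- Computable partial maps from Tuple p q to Tuple p′ q′, and their graphs.
record Functional (p q p′ q′ : ℕ) : Set where
  field
    numProgs : Vec (Prog q p) p′
    funProgs : Vec (Prog q (suc p)) q′

open Functional public

Maps : ∀ {p q p′ q′} → Functional p q p′ q′ → Tuple p q → Tuple p′ q′ → Set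
Maps η x y = Pointwise (λ e n → Eval (funs x) e (nums x) n) (numProgs η) (nums y)
           × Pointwise (λ e f → Computes e x f) (funProgs η) (funs y)

-- Computable partial maps (α , x̄) ↦ β; α is the first oracle.
WitnessMap : ℕ → ℕ → Set
WitnessMap p q = Prog (suc q) (suc p)

MapsWitness : ∀ {p q} → WitnessMap p q → Baire → Tuple p q → Baire → Set
MapsWitness r α (tuple ns fs) β = Computes r (tuple ns (α ∷ fs)) β

------------------------------------------------------------------------
-- Bounded formulas

-- Application of a function parameter of several arguments goes through
-- the pairing, whose graph is bounded-definable from + and *; having it as
-- a term former does not enlarge the class of bounded formulas.
data Term (p q : ℕ) : Set where
  var     : Fin p → Term p q
  zero    : Term p q
  suc     : Term p q → Term p q
  _`+_    : Term p q → Term p q → Term p q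
  _`*_    : Term p q → Term p q → Term p q
  ⟪_,_⟫   : Term p q → Term p q → Term p q
  _·_     : Fin q → Term p q → Term p q

infix  9 _·_
infixl 8 _`*_
infixl 7 _`+_
infix  6 _`≡_ _`≤_
infixr 5 _`∧_
infixr 4 _`∨_
infixr 3 _`⇒_

-- Number variables are de Bruijn indices.
data Bounded (p q : ℕ) : Set where
  _`≡_ _`≤_        : Term p q → Term p q → Bounded p q
  `¬_              : Bounded p q → Bounded p q
  _`∧_ _`∨_ _`⇒_   : Bounded p q → Bounded p q → Bounded p q
  `∀<_∙_ `∃<_∙_    : Term p q → Bounded (suc p) q → Bounded p q

infix 5 `¬_

⟦_⟧ᵗ : ∀ {p q} → Term p q → Tuple p q → ℕ
⟦ var i ⟧ᵗ     x = lookup (nums x) i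
⟦ zero ⟧ᵗ      x = 0
⟦ suc s ⟧ᵗ     x = suc (⟦ s ⟧ᵗ x)
⟦ s `+ t ⟧ᵗ    x = ⟦ s ⟧ᵗ x + ⟦ t ⟧ᵗ x
⟦ s `* t ⟧ᵗ    x = ⟦ s ⟧ᵗ x * ⟦ t ⟧ᵗ x
⟦ ⟪ s , t ⟫ ⟧ᵗ x = pair (⟦ s ⟧ᵗ x) (⟦ t ⟧ᵗ x)
⟦ i · t ⟧ᵗ     x = lookup (funs x) i (⟦ t ⟧ᵗ x)

⟦_⟧ : ∀ {p q} → Bounded p q → Tuple p q → Set
⟦ s `≡ t ⟧   x = ⟦ s ⟧ᵗ x ≡ ⟦ t ⟧ᵗ x
⟦ s `≤ t ⟧   x = ⟦ s ⟧ᵗ x ≤ ⟦ t ⟧ᵗ x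
⟦ `¬ θ ⟧     x = ¬ ⟦ θ ⟧ x
⟦ θ `∧ θ′ ⟧  x = ⟦ θ ⟧ x × ⟦ θ′ ⟧ x
⟦ θ `∨ θ′ ⟧  x = ⟦ θ ⟧ x ⊎ ⟦ θ′ ⟧ x
⟦ θ `⇒ θ′ ⟧  x = ⟦ θ ⟧ x → ⟦ θ′ ⟧ x
⟦ `∀< t ∙ θ ⟧ x = ∀ n → n < ⟦ t ⟧ᵗ x → ⟦ θ ⟧ (n ▸ x)
⟦ `∃< t ∙ θ ⟧ x = ∃[ n ] n < ⟦ t ⟧ᵗ x × ⟦ θ ⟧ (n ▸ x)

------------------------------------------------------------------------
-- Quantifier patterns, formulas, truth, witnesses, duals

data Quantifier : Set where
  `∃ `∀ `∃∞ `∀∞ : Quantifier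

Pattern : Set
Pattern = List Quantifier

data Formula : Pattern → ℕ → ℕ → Set where
  matrix : ∀ {p q} → Bounded p q → Formula [] p q
  quant  : ∀ {Qs p q} (Q : Quantifier) → Formula Qs (suc p) q → Formula (Q ∷ Qs) p q

True : ∀ {Qs p q} → Formula Qs p q → Tuple p q → Set
True (matrix θ)    x = ⟦ θ ⟧ x
True (quant `∃  φ) x = ∃[ n ] True φ (n ▸ x)
True (quant `∀  φ) x = ∀ n → True φ (n ▸ x)
True (quant `∃∞ φ) x = ∀ m → ∃[ n ] m ≤ n × True φ (n ▸ x)
True (quant `∀∞ φ) x = ∃[ m ] (∀ n → m ≤ n → True φ (n ▸ x))

infix 4 _⊩_[_]

_⊩_[_] : ∀ {Qs p q} → Baire → Formula Qs p q → Tuple p q → Set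
α ⊩ matrix θ    [ x ] = α ≗ encode x × ⟦ θ ⟧ x
α ⊩ quant `∃ φ  [ x ] = tail α ⊩ φ [ head α ▸ x ]
α ⊩ quant `∀ φ  [ x ] = ∀ n → row α n ⊩ φ [ n ▸ x ]
α ⊩ quant `∃∞ φ [ x ] = ∀ n → n ≤ head (row α n)
                             × tail (row α n) ⊩ φ [ head (row α n) ▸ x ]
α ⊩ quant `∀∞ φ [ x ] = ∀ n → head α ≤ n → row (tail α) n ⊩ φ [ n ▸ x ]

dualQ : Quantifier → Quantifier
dualQ `∃  = `∀
dualQ `∀  = `∃
dualQ `∃∞ = `∀∞
dualQ `∀∞ = `∃∞

dualFormula : ∀ {Qs p q} → Formula Qs p q → Formula (map dualQ Qs) p q
dualFormula (matrix θ)  = matrix (`¬ θ)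
dualFormula (quant Q φ) = quant (dualQ Q) (dualFormula φ)

------------------------------------------------------------------------
-- Reducibility

-- A formula together with the class of tuples it is about; for a formula
-- about countable structures these are the codes of such structures.
record Problem (Qs : Pattern) (p q : ℕ) : Set₁ where
  field
    formula : Formula Qs p q
    Domain  : Tuple p q → Set

open Problem public

unrestricted : ∀ {Qs p q} → Formula Qs p q → Problem Qs p q
unrestricted φ = record { formula = φ ; Domain = λ _ → ⊤ }

dual : ∀ {Qs p q} → Problem Qs p q → Problem (map dualQ Qs) p q
dual P = record { formula = dualFormula (formula P) ; Domain = Domain P }

IsInstance : ∀ {Qs p q} → Problem Qs p q → Tuple p q → Set
IsInstance P x = All Computable (funs x) × Domain P x

-- Eval is deterministic, so y is η(x̄) and each β is the value of r₋ or r₊.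
-- The existential quantifiers say that the partial maps are defined where
-- required.
Reduces : ∀ {Qs p q Qs′ p′ q′} → Problem Qs p q → Problem Qs′ p′ q′ →
          Functional p q p′ q′ → WitnessMap p q → WitnessMap p q → Set
Reduces P P′ η r₋ r₊ = ∀ x → IsInstance P x →
  ∃[ y ] Maps η x y × IsInstance P′ y
       × (True φ x ⇔ True ψ y)
       × (∀ α → α ⊩ φ [ x ] → ∃[ β ] MapsWitness r₋ α x β × β ⊩ ψ [ y ])
       × (∀ α → α ⊩ ψ [ y ] → ∃[ β ] MapsWitness r₊ α x β × β ⊩ φ [ x ])
  where
  φ = formula P
  ψ = formula P′

ReducesVia : ∀ {Qs p q Qs′ p′ q′} → Functional p q p′ q′ →
             Problem Qs p q → Problem Qs′ p′ q′ → Set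
ReducesVia η P P′ = ∃[ r₋ ] ∃[ r₊ ] Reduces P P′ η r₋ r₊

infix 4 _≤dm_ _≡dm_

_≤dm_ : ∀ {Qs p q Qs′ p′ q′} → Problem Qs p q → Problem Qs′ p′ q′ → Set
P ≤dm P′ = ∃[ η ] ReducesVia η P P′ × ReducesVia η (dual P) (dual P′)

_≡dm_ : ∀ {Qs p q Qs′ p′ q′} → Problem Qs p q → Problem Qs′ p′ q′ → Set
P ≡dm P′ = P ≤dm P′ × P′ ≤dm P

StrictlyDicomplete : ∀ {Qs p q} → Formula Qs p q → Set
StrictlyDicomplete {Qs} φ =
  ∀ {p q} (ψ : Formula Qs p q) → unrestricted ψ ≤dm unrestricted φ

Dicomplete : ∀ {Rs p q} → Pattern → Problem Rs p q → Set
Dicomplete Qs P =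
  ∃[ p ] ∃[ q ] Σ[ φ ∈ Formula Qs p q ] StrictlyDicomplete φ × P ≡dm unrestricted φ

------------------------------------------------------------------------
-- Bounded partial orders and complements

-- X and R (via pair) are the characteristic functions of the universe and
-- of the order relation.
record IsBoundedPoset (top bot : ℕ) (X R : Baire) : Set where
  Carrier : Set
  Carrier = ∃[ a ] X a ≡ 1

  _≼_ : Carrier → Carrier → Set
  (a , _) ≼ (b , _) = R (pair a b) ≡ 1

  field
    X-characteristic : ∀ n → X n ≤ 1
    R-characteristic : ∀ n → R n ≤ 1
    R⊆X²             : ∀ a b → R (pair a b) ≡ 1 → X a ≡ 1 × X b ≡ 1
    isPartialOrder   : IsPartialOrder (_≡_ on proj₁) _≼_
    top∈X            : X top ≡ 1
    bot∈X            : X bot ≡ 1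
    maximum          : Maximum _≼_ (top , top∈X)
    minimum          : Minimum _≼_ (bot , bot∈X)

BoundedPosetCode : Tuple 2 2 → Set
BoundedPosetCode (tuple (top ∷ bot ∷ []) (X ∷ R ∷ [])) = IsBoundedPoset top bot X R

complMatrix : Bounded 5 2
complMatrix =
  inP a `⇒ (inP b `∧ (inP c `⇒
    `¬ ((a ≤ₚ c `∧ b ≤ₚ c `∧ c <ₚ top) `∨ (bot <ₚ c `∧ c ≤ₚ a `∧ c ≤ₚ b))))
  where
  c b a top bot : Term 5 2
  c   = var 0F
  b   = var 1F
  a   = var 2F
  top = var 3F
  bot = var 4F

  infix 6 _≤ₚ_ _<ₚ_

  inP : Term 5 2 → Bounded 5 2
  inP s = 0F · s `≡ suc zero

  _≤ₚ_ _<ₚ_ : Term 5 2 → Term 5 2 → Bounded 5 2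
  s ≤ₚ t = 1F · ⟪ s , t ⟫ `≡ suc zero
  s <ₚ t = s ≤ₚ t `∧ `¬ (s `≡ t)

Compl : Problem (`∀ ∷ `∃ ∷ `∀ ∷ []) 2 2
Compl = record
  { formula = quant `∀ (quant `∃ (quant `∀ (matrix complMatrix)))
  ; Domain  = BoundedPosetCode
  }

{-# OPTIONS --safe #-}
-- Bounded formulas have primitive recursive characteristic functions, so the
-- formula ∀ a ∃ b ∀ c. x(a, b, c) = 0 is strictly dicomplete.  It reduces to
-- Compl by a poset with elements P a b, Q a b, T a b, Z a b, U a b, V a b and
-- R a b c besides top and bot.  Independently of x, all Q and R have the
-- complement V 0 0, T a b and Z a b are complements of each other, and so are
-- U a b and V a b.  The elements U above and T below make P a _ clash with
-- everything but the Q a b, and a common bound of P a _ and Q a b can only be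
-- an upper bound R a b c, which is one iff x(a, b, c) ≠ 0.  Thus the complements
-- of P a _ are the Q a b with ∀ c. x(a, b, c) = 0, and what refutes such a
-- complement is an R a b c with x(a, b, c) ≠ 0; the translations of witnesses
-- in both directions, for the formulas and for their duals, only read off indices.
module Submission where

open import Data.Fin.Base using (Fin; zero; suc)
open import Data.Fin.Patterns using (0F; 1F; 2F; 3F; 4F; 5F; 6F)
open import Data.List.Base using ([]; _∷_)
open import Data.Nat.Base
  using (ℕ; zero; suc; pred; _+_; _*_; _∸_; _≤_; _<_; z≤n; s≤s; s≤s⁻¹)
open import Data.Nat.Properties
open import Data.Product.Base using (∃-syntax; _×_; proj₁; proj₂; _,_)
open import Data.Sum.Base using (_⊎_; inj₁; inj₂; [_,_]′)
open import Data.Unit.Base using (⊤; tt)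
open import Data.Vec.Base using (Vec; []; _∷_; lookup; tabulate; map)
open import Data.Vec.Properties using (lookup∘tabulate)
open import Data.Vec.Relation.Binary.Pointwise.Inductive using (Pointwise; []; _∷_)
open import Data.Vec.Relation.Unary.All using (All; []; _∷_)
open import Function.Base using (_∘_; id)
open import Function.Bundles using (mk⇔)
open import Relation.Binary.Definitions using (Transitive; Antisymmetric)
open import Relation.Binary.PropositionalEquality
  using (_≡_; _≢_; refl; sym; trans; cong; cong₂; subst; subst₂)
open import Relation.Nullary.Decidable.Core using (decidable-stable)
open import Relation.Nullary.Negation.Core using (¬_; contradiction)

open import Defs

private
  variable
    k m n p q p′ q′ : ℕ
    A B : Set

-- Total computable functionals

EvalAll : Vec Baire q → Vec ℕ n → Vec (Prog q n) m → Vec ℕ m → Set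
EvalAll O xs = Pointwise (λ e y → Eval O e xs y)

projs : (Fin m → Fin n) → Vec (Prog q n) m
projs ρ = tabulate λ i → proj (ρ i)

evalProjs : ∀ {O : Vec Baire q} (ρ : Fin m → Fin n) {xs : Vec ℕ n} (ys : Vec ℕ m) →
            (∀ i → lookup xs (ρ i) ≡ lookup ys i) →
            EvalAll O xs (projs ρ) ys
evalProjs ρ []       eq = []
evalProjs ρ (y ∷ ys) eq =
  subst (Eval _ _ _) (eq 0F) (proj (ρ 0F)) ∷ evalProjs (λ i → ρ (suc i)) ys (λ i → eq (suc i))

-- A program bundled with the total function it computes. Later arguments are about `apply`, an
-- ordinary function, and `run` carries them over to `Eval`. The combinators below never use `mu`.
record Recursive (q n : ℕ) : Set where
  constructor recursive
  field
    program : Prog q n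
    apply   : Vec Baire q → Vec ℕ n → ℕ
    run     : ∀ O xs → Eval O program xs (apply O xs)

open Recursive

record Substitution (q m n : ℕ) : Set where
  constructor substitution
  field
    programs : Vec (Prog q n) m
    applyAll : Vec Baire q → Vec ℕ n → Vec ℕ m
    runAll   : ∀ O xs → EvalAll O xs programs (applyAll O xs)

open Substitution

infixl 9 _[_]
infix  1 ifᴿ_then_else_
infixr 5 _∷ˢ_

_[_] : Recursive q m → Substitution q m n → Recursive q n
f [ σ ] = record
  { program = comp (program f) (programs σ)
  ; apply   = λ O xs → apply f O (applyAll σ O xs)
  ; run     = λ O xs → comp (runAll σ O xs) (run f O _)
  }

[]ˢ : Substitution q 0 n
[]ˢ = substitution [] (λ _ _ → []) (λ _ _ → [])

_∷ˢ_ : Recursive q n → Substitution q m n → Substitution q (suc m) n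
f ∷ˢ σ = record
  { programs = program f ∷ programs σ
  ; applyAll = λ O xs → apply f O xs ∷ applyAll σ O xs
  ; runAll   = λ O xs → run f O xs ∷ runAll σ O xs
  }

idˢ : Substitution q n n
idˢ = substitution (projs id) (λ _ xs → xs) (λ _ xs → evalProjs id xs λ _ → refl)

dropˢ : Substitution q n (suc n)
dropˢ = record
  { programs = projs suc
  ; applyAll = λ { _ (_ ∷ xs) → xs }
  ; runAll   = λ { _ (_ ∷ xs) → evalProjs suc xs λ _ → refl }
  }

drop₂ˢ : Substitution q n (suc (suc n))
drop₂ˢ = record
  { programs = projs (λ i → suc (suc i))
  ; applyAll = λ { _ (_ ∷ _ ∷ xs) → xs }
  ; runAll   = λ { _ (_ ∷ _ ∷ xs) → evalProjs (λ i → suc (suc i)) xs λ _ → refl }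
  }

-- Replaces the recursion by which a program computes with the familiar operation, so that `apply`
-- unfolds to the latter.
computing : (f : Recursive q n) (g : Vec Baire q → Vec ℕ n → ℕ) →
            (∀ O xs → apply f O xs ≡ g O xs) → Recursive q n
computing f g eq = record
  { program = program f
  ; apply   = g
  ; run     = λ O xs → subst (Eval O (program f) xs) (eq O xs) (run f O xs)
  }

fold : ℕ → (ℕ → ℕ → ℕ) → ℕ → ℕ
fold y f zero    = y
fold y f (suc k) = f k (fold y f k)

precᴿ : Recursive q n → Recursive q (suc (suc n)) → Recursive q (suc n)
precᴿ {q} {n} f g = record
  { program = prec (program f) (program g)
  ; apply   = λ { O (k ∷ xs) → value O xs k }
  ; run     = λ { O (k ∷ xs) → evaluation O xs k }
  }
  where
  value : Vec Baire q → Vec ℕ n → ℕ → ℕ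
  value O xs = fold (apply f O xs) (λ k y → apply g O (k ∷ y ∷ xs))

  evaluation : ∀ O xs k → Eval O (prec (program f) (program g)) (k ∷ xs) (value O xs k)
  evaluation O xs zero    = prec-zero (run f O xs)
  evaluation O xs (suc k) = prec-suc (evaluation O xs k) (run g O _)

varᴿ : Fin n → Recursive q n
varᴿ i = recursive (proj i) (λ _ xs → lookup xs i) (λ _ _ → proj i)

zeroᴿ : Recursive q n
zeroᴿ = recursive zero (λ _ _ → 0) (λ _ _ → zero)

sucᴿ : Recursive q n → Recursive q n
sucᴿ f = recursive suc (λ { _ (x ∷ []) → suc x }) (λ { _ (x ∷ []) → suc }) [ f ∷ˢ []ˢ ]

constᴿ : ℕ → Recursive q n
constᴿ zero    = zeroᴿ
constᴿ (suc k) = sucᴿ (constᴿ k)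

oracleᴿ : Fin q → Recursive q n → Recursive q n
oracleᴿ i f =
  recursive (oracle i) (λ { O (x ∷ []) → lookup O i x }) (λ { _ (x ∷ []) → oracle i })
    [ f ∷ˢ []ˢ ]

infixl 6 _+ᴿ_ _∸ᴿ_
infixl 7 _*ᴿ_

_+ᴿ_ : Recursive q n → Recursive q n → Recursive q n
f +ᴿ g = add [ f ∷ˢ g ∷ˢ []ˢ ]
  where
  add : Recursive q 2
  add = computing (precᴿ (varᴿ 0F) (sucᴿ (varᴿ 1F))) (λ { _ (x ∷ y ∷ []) → x + y })
          λ { _ (x ∷ y ∷ []) → fold-+ x y }
    where
    fold-+ : ∀ x y → fold y (λ _ → suc) x ≡ x + y
    fold-+ zero    y = refl
    fold-+ (suc x) y = cong suc (fold-+ x y)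

_*ᴿ_ : Recursive q n → Recursive q n → Recursive q n
f *ᴿ g = mul [ f ∷ˢ g ∷ˢ []ˢ ]
  where
  mul : Recursive q 2
  mul = computing (precᴿ zeroᴿ (varᴿ 2F +ᴿ varᴿ 1F)) (λ { _ (x ∷ y ∷ []) → x * y })
          λ { _ (x ∷ y ∷ []) → fold-* x y }
    where
    fold-* : ∀ x y → fold 0 (λ _ → y +_) x ≡ x * y
    fold-* zero    y = refl
    fold-* (suc x) y = cong (y +_) (fold-* x y)

predᴿ : Recursive q n → Recursive q n
predᴿ f = predecessor [ f ∷ˢ []ˢ ]
  where
  predecessor : Recursive q 1
  predecessor = computing (precᴿ zeroᴿ (varᴿ 0F)) (λ { _ (x ∷ []) → pred x })
                  λ { _ (zero ∷ []) → refl ; _ (suc x ∷ []) → refl }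

_∸ᴿ_ : Recursive q n → Recursive q n → Recursive q n
-- `prec` recurses on the first argument, which has to be the subtrahend.
f ∸ᴿ g = monus [ g ∷ˢ f ∷ˢ []ˢ ]
  where
  monus : Recursive q 2
  monus = computing (precᴿ (varᴿ 0F) (predᴿ (varᴿ 1F))) (λ { _ (y ∷ x ∷ []) → x ∸ y })
            λ { _ (y ∷ x ∷ []) → fold-∸ x y }
    where
    fold-∸ : ∀ x y → fold x (λ _ → pred) y ≡ x ∸ y
    fold-∸ x zero    = refl
    fold-∸ x (suc y) = trans (cong pred (fold-∸ x y)) (pred[m∸n]≡m∸[1+n] x y)

ifNonZero : {A : Set} → ℕ → A → A → A
ifNonZero zero    x y = y
ifNonZero (suc _) x y = x

-- Both branches are evaluated, which is harmless because they are total.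
ifᴿ_then_else_ : Recursive q n → Recursive q n → Recursive q n → Recursive q n
ifᴿ f then g else h = cond [ f ∷ˢ g ∷ˢ h ∷ˢ []ˢ ]
  where
  cond : Recursive q 3
  cond = computing (precᴿ (varᴿ 1F) (varᴿ 2F)) (λ { _ (b ∷ x ∷ y ∷ []) → ifNonZero b x y })
           λ { _ (zero ∷ x ∷ y ∷ []) → refl ; _ (suc b ∷ x ∷ y ∷ []) → refl }

switch : Recursive q n → Vec (Recursive q n) k → Recursive q n → Recursive q n
switch f []       d = d
switch f (b ∷ bs) d = ifᴿ f then switch (predᴿ f) bs d else b

-- Cantor's pairing and its inverse

triangleᴿ : Recursive q n → Recursive q n
triangleᴿ f = tri [ f ∷ˢ []ˢ ]
  where
  tri : Recursive q 1
  tri = computing (precᴿ zeroᴿ (sucᴿ (varᴿ 0F) +ᴿ varᴿ 1F)) (λ { _ (x ∷ []) → triangle x })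
          λ { _ (x ∷ []) → fold-triangle x }
    where
    fold-triangle : ∀ x → fold 0 (λ k y → suc k + y) x ≡ triangle x
    fold-triangle zero    = refl
    fold-triangle (suc x) = cong (suc x +_) (fold-triangle x)

pairᴿ : Recursive q n → Recursive q n → Recursive q n
pairᴿ f g = triangleᴿ (f +ᴿ g) +ᴿ f

-- The largest w with triangle w ≤ n; it is i + j when n = pair i j.
diagonal : ℕ → ℕ
diagonal zero    = 0
diagonal (suc n) =
  ifNonZero (triangle (suc (diagonal n)) ∸ suc n) (diagonal n) (suc (diagonal n))

diagonalᴿ : Recursive q n → Recursive q n
diagonalᴿ f = diag [ f ∷ˢ []ˢ ]
  where
  diag : Recursive q 1
  diag = computing
      (precᴿ zeroᴿ (ifᴿ triangleᴿ (sucᴿ (varᴿ 1F)) ∸ᴿ sucᴿ (varᴿ 0F)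
                    then varᴿ 1F else sucᴿ (varᴿ 1F)))
      (λ { _ (x ∷ []) → diagonal x })
      λ { _ (x ∷ []) → fold-diagonal x }
    where
    fold-diagonal : ∀ x →
      fold 0 (λ k y → ifNonZero (triangle (suc y) ∸ suc k) y (suc y)) x ≡ diagonal x
    fold-diagonal zero    = refl
    fold-diagonal (suc x) =
      cong (λ y → ifNonZero (triangle (suc y) ∸ suc x) y (suc y)) (fold-diagonal x)

diagonal-bounds : ∀ n → triangle (diagonal n) ≤ n × n < triangle (suc (diagonal n))
diagonal-bounds zero = z≤n , s≤s z≤n
diagonal-bounds (suc n)
  with diagonal-bounds n | triangle (suc (diagonal n)) ∸ suc n in eq
... | _  , hi | zero  = m∸n≡0⇒m≤n eq ,
  <-≤-trans (s≤s hi) (s≤s (m≤n+m _ (suc (diagonal n))))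
... | lo , _  | suc k = m≤n⇒m≤1+n lo , m∸n≢0⇒n<m λ eq′ → 1+n≢0 (trans (sym eq) eq′)

triangle-mono : ∀ {m n} → m ≤ n → triangle m ≤ triangle n
triangle-mono z≤n       = z≤n
triangle-mono (s≤s m≤n) = +-mono-≤ (s≤s m≤n) (triangle-mono m≤n)

-- If `w < v`, then `triangle (suc w) ≤ triangle v ≤ n`, against `n < triangle (suc w)`.
triangle-gap : ∀ {v w n} → triangle v ≤ n → n < triangle (suc w) → v ≤ w
triangle-gap {v} {w} lo hi with ≤-total v w
... | inj₁ v≤w = v≤w
... | inj₂ w≤v with m≤n⇒m<n∨m≡n w≤v
...   | inj₁ w<v  = contradiction (<-≤-trans hi (≤-trans (triangle-mono w<v) lo)) (<-irrefl refl)
...   | inj₂ refl = ≤-refl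

-- Both `i + j` and `diagonal (pair i j)` are numbers `w` with
-- `triangle w ≤ pair i j < triangle (suc w)`, and `triangle-gap` allows only one.
diagonal-pair : ∀ i j → diagonal (pair i j) ≡ i + j
diagonal-pair i j = ≤-antisym (triangle-gap lo (s≤s hi)) (triangle-gap (m≤m+n _ i) hi′)
  where
  lo  = proj₁ (diagonal-bounds (pair i j))
  hi′ = proj₂ (diagonal-bounds (pair i j))
  hi : pair i j ≤ i + j + triangle (i + j)
  hi = ≤-trans (≤-reflexive (+-comm (triangle (i + j)) i))
               (+-monoˡ-≤ (triangle (i + j)) (m≤m+n i j))

-- Conversion checking must not unfold the search for the diagonal; outside, `fst` and `snd` are
-- known by their programs and the three equations of a pairing.
abstract
  fst snd : ℕ → ℕ
  fst n = n ∸ triangle (diagonal n)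
  snd n = diagonal n ∸ fst n

  fstProgram sndProgram : Prog q 1
  fstProgram = program (varᴿ 0F ∸ᴿ triangleᴿ (diagonalᴿ (varᴿ 0F)))
  sndProgram = program (diagonalᴿ (varᴿ 0F) ∸ᴿ (varᴿ 0F ∸ᴿ triangleᴿ (diagonalᴿ (varᴿ 0F))))

  run-fst : ∀ (O : Vec Baire q) x → Eval O fstProgram (x ∷ []) (fst x)
  run-fst O x = run (varᴿ 0F ∸ᴿ triangleᴿ (diagonalᴿ (varᴿ 0F))) O (x ∷ [])

  run-snd : ∀ (O : Vec Baire q) x → Eval O sndProgram (x ∷ []) (snd x)
  run-snd O x =
    run (diagonalᴿ (varᴿ 0F) ∸ᴿ (varᴿ 0F ∸ᴿ triangleᴿ (diagonalᴿ (varᴿ 0F)))) O (x ∷ [])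

  fst-pair : ∀ i j → fst (pair i j) ≡ i
  fst-pair i j rewrite diagonal-pair i j = m+n∸m≡n (triangle (i + j)) i

  snd-pair : ∀ i j → snd (pair i j) ≡ j
  snd-pair i j rewrite fst-pair i j | diagonal-pair i j = m+n∸m≡n i j

  pair-fst-snd : ∀ n → pair (fst n) (snd n) ≡ n
  pair-fst-snd n = trans (cong (λ w → triangle w + fst n) (m+[n∸m]≡n fst≤diagonal))
                         (m+[n∸m]≡n (proj₁ (diagonal-bounds n)))
    where
    fst≤diagonal : fst n ≤ diagonal n
    fst≤diagonal = m≤n+o⇒m∸n≤o n (triangle (diagonal n)) (≤-trans
      (s≤s⁻¹ (proj₂ (diagonal-bounds n)))
      (≤-reflexive (+-comm (diagonal n) _)))

fstᴿ sndᴿ : Recursive q n → Recursive q n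
fstᴿ f =
  recursive fstProgram (λ { _ (x ∷ []) → fst x }) (λ { O (x ∷ []) → run-fst O x }) [ f ∷ˢ []ˢ ]
sndᴿ f =
  recursive sndProgram (λ { _ (x ∷ []) → snd x }) (λ { O (x ∷ []) → run-snd O x }) [ f ∷ˢ []ˢ ]

-- Bounded formulas are decidable

-- The truth value is an index, so that matching on a proof also replaces the computed number by 0
-- or 1.
data Decides (A : Set) : ℕ → Set where
  true : A → Decides A 1
  false  : ¬ A → Decides A 0

decides-map : (A → B) → (B → A) → Decides A k → Decides B k
decides-map f g (true x) = true (f x)
decides-map f g (false ¬x) = false (¬x ∘ g)

decides-¬ : Decides A m → Decides (¬ A) (ifNonZero m 0 1)
decides-¬ (true x) = false (λ ¬x → ¬x x)
decides-¬ (false ¬x) = true ¬x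

decides-× : Decides A m → Decides B n → Decides (A × B) (ifNonZero m n 0)
decides-× (true x) d = decides-map (x ,_) proj₂ d
decides-× (false ¬x) d = false (¬x ∘ proj₁)

decides-⊎ : Decides A m → Decides B n → Decides (A ⊎ B) (ifNonZero m 1 n)
decides-⊎ (true x) d = true (inj₁ x)
decides-⊎ (false ¬x) d = decides-map inj₂ [ (λ x → contradiction x ¬x) , id ]′ d

decides-→ : Decides A m → Decides B n → Decides (A → B) (ifNonZero m n 1)
decides-→ (true x) d = decides-map (λ y _ → y) (λ f → f x) d
decides-→ (false ¬x) d = true (λ x → contradiction x ¬x)

decides-≤ : ∀ m n → Decides (m ≤ n) (ifNonZero (m ∸ n) 0 1)
decides-≤ m n with m ∸ n in eq
... | zero  = true (m∸n≡0⇒m≤n eq)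
... | suc _ = false λ m≤n → 0≢1+n (trans (sym (m≤n⇒m∸n≡0 m≤n)) eq)

equal : ℕ → ℕ → ℕ
equal m n = ifNonZero (ifNonZero (m ∸ n) 0 1) (ifNonZero (n ∸ m) 0 1) 0

decides-≡ : ∀ m n → Decides (m ≡ n) (equal m n)
decides-≡ m n = decides-map (λ (m≤n , n≤m) → ≤-antisym m≤n n≤m) (λ { refl → ≤-refl , ≤-refl })
                  (decides-× (decides-≤ m n) (decides-≤ n m))

decides-∀< : {A : ℕ → Set} {f : ℕ → ℕ} → (∀ k → Decides (A k) (f k)) → ∀ n →
             Decides (∀ k → k < n → A k) (fold 1 (λ k b → ifNonZero b (f k) 0) n)
decides-∀< d zero    = true λ _ ()
decides-∀< {A} d (suc n) = decides-map
  (λ (below , here) k k<1+n →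
    [ below k , (λ { refl → here }) ]′ (m<1+n⇒m<n∨m≡n k<1+n))
  (λ all → (λ k k<n → all k (m<n⇒m<1+n k<n)) , all n ≤-refl)
  (decides-× (decides-∀< d n) (d n))

decides-∃< : {A : ℕ → Set} {f : ℕ → ℕ} → (∀ k → Decides (A k) (f k)) → ∀ n →
             Decides (∃[ k ] k < n × A k) (fold 0 (λ k b → ifNonZero b 1 (f k)) n)
decides-∃< d zero    = false λ { (_ , () , _) }
decides-∃< {A} d (suc n) = decides-map
  [ (λ (k , k<n , x) → k , m<n⇒m<1+n k<n , x) , (λ x → n , ≤-refl , x) ]′
  (λ (k , k<1+n , x) →
    [ (λ k<n → inj₁ (k , k<n , x)) , (λ { refl → inj₂ x }) ]′ (m<1+n⇒m<n∨m≡n k<1+n))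
  (decides-⊎ (decides-∃< d n) (d n))

_≤ᴿ_ _≡ᴿ_ : Recursive q n → Recursive q n → Recursive q n
f ≤ᴿ g = ifᴿ f ∸ᴿ g then zeroᴿ else constᴿ 1
f ≡ᴿ g = ifᴿ f ≤ᴿ g then g ≤ᴿ f else zeroᴿ

termᴿ : Term p q → Recursive q p
termᴿ (var i)   = varᴿ i
termᴿ zero      = zeroᴿ
termᴿ (suc s)   = sucᴿ (termᴿ s)
termᴿ (s `+ t)  = termᴿ s +ᴿ termᴿ t
termᴿ (s `* t)  = termᴿ s *ᴿ termᴿ t
termᴿ ⟪ s , t ⟫ = pairᴿ (termᴿ s) (termᴿ t)
termᴿ (i · t)   = oracleᴿ i (termᴿ t)

apply-termᴿ : ∀ (t : Term p q) O ns → apply (termᴿ t) O ns ≡ ⟦ t ⟧ᵗ (tuple ns O)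
apply-termᴿ (var i)   O ns = refl
apply-termᴿ zero      O ns = refl
apply-termᴿ (suc s)   O ns = cong suc (apply-termᴿ s O ns)
apply-termᴿ (s `+ t)  O ns = cong₂ _+_ (apply-termᴿ s O ns) (apply-termᴿ t O ns)
apply-termᴿ (s `* t)  O ns = cong₂ _*_ (apply-termᴿ s O ns) (apply-termᴿ t O ns)
apply-termᴿ ⟪ s , t ⟫ O ns = cong₂ pair (apply-termᴿ s O ns) (apply-termᴿ t O ns)
apply-termᴿ (i · t)   O ns = cong (lookup O i) (apply-termᴿ t O ns)

χ : Bounded p q → Recursive q p
χ (s `≡ t)    = termᴿ s ≡ᴿ termᴿ t
χ (s `≤ t)    = termᴿ s ≤ᴿ termᴿ t
χ (`¬ θ)      = ifᴿ χ θ then zeroᴿ else constᴿ 1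
χ (θ `∧ θ′)   = ifᴿ χ θ then χ θ′ else zeroᴿ
χ (θ `∨ θ′)   = ifᴿ χ θ then constᴿ 1 else χ θ′
χ (θ `⇒ θ′)   = ifᴿ χ θ then χ θ′ else constᴿ 1
χ (`∀< t ∙ θ) =
  -- The recursion runs up to the bound. `varᴿ 0F` is the counter, which becomes the bound variable,
  -- and `varᴿ 1F` the truth value so far; `drop₂ˢ` removes both.
  precᴿ (constᴿ 1) (ifᴿ varᴿ 1F then χ θ [ varᴿ 0F ∷ˢ drop₂ˢ ] else zeroᴿ) [ termᴿ t ∷ˢ idˢ ]
χ (`∃< t ∙ θ) =
  precᴿ zeroᴿ (ifᴿ varᴿ 1F then constᴿ 1 else χ θ [ varᴿ 0F ∷ˢ drop₂ˢ ]) [ termᴿ t ∷ˢ idˢ ]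

χ-decides : ∀ (θ : Bounded p q) O ns → Decides (⟦ θ ⟧ (tuple ns O)) (apply (χ θ) O ns)
χ-decides (s `≡ t)    O ns rewrite apply-termᴿ s O ns | apply-termᴿ t O ns = decides-≡ _ _
χ-decides (s `≤ t)    O ns rewrite apply-termᴿ s O ns | apply-termᴿ t O ns = decides-≤ _ _
χ-decides (`¬ θ)      O ns = decides-¬ (χ-decides θ O ns)
χ-decides (θ `∧ θ′)   O ns = decides-× (χ-decides θ O ns) (χ-decides θ′ O ns)
χ-decides (θ `∨ θ′)   O ns = decides-⊎ (χ-decides θ O ns) (χ-decides θ′ O ns)
χ-decides (θ `⇒ θ′)   O ns = decides-→ (χ-decides θ O ns) (χ-decides θ′ O ns)
χ-decides (`∀< t ∙ θ) O ns rewrite apply-termᴿ t O ns =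
  decides-∀< (λ k → χ-decides θ O (k ∷ ns)) _
χ-decides (`∃< t ∙ θ) O ns rewrite apply-termᴿ t O ns =
  decides-∃< (λ k → χ-decides θ O (k ∷ ns)) _

-- Relative computability

mutual
  substOracles : Vec (Prog q′ 1) q → Prog q n → Prog q′ n
  substOracles es zero        = zero
  substOracles es suc         = suc
  substOracles es (proj i)    = proj i
  substOracles es (oracle i)  = lookup es i
  substOracles es (comp g hs) = comp (substOracles es g) (substOraclesAll es hs)
  substOracles es (prec g h)  = prec (substOracles es g) (substOracles es h)
  substOracles es (mu f)      = mu (substOracles es f)

  substOraclesAll : Vec (Prog q′ 1) q → Vec (Prog q n) m → Vec (Prog q′ n) m
  substOraclesAll es []       = []
  substOraclesAll es (h ∷ hs) = substOracles es h ∷ substOraclesAll es hs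

module _ {O : Vec Baire q} {O′ : Vec Baire q′} {es : Vec (Prog q′ 1) q}
         (computes : ∀ i x → Eval O′ (lookup es i) (x ∷ []) (lookup O i x)) where
  mutual
    evalSubst : ∀ {e : Prog q n} {xs y} → Eval O e xs y → Eval O′ (substOracles es e) xs y
    evalSubst zero            = zero
    evalSubst suc             = suc
    evalSubst (proj i)        = proj i
    evalSubst (oracle i)      = computes i _
    evalSubst (comp ds d)     = comp (evalSubstAll ds) (evalSubst d)
    evalSubst (prec-zero d)   = prec-zero (evalSubst d)
    evalSubst (prec-suc d d′) = prec-suc (evalSubst d) (evalSubst d′)
    evalSubst (mu ds d)       = mu (λ j j<k → evalSubst∃ (ds j j<k)) (evalSubst d)

    evalSubst∃ : ∀ {e : Prog q n} {xs} → ∃[ y ] Eval O e xs (suc y) →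
                 ∃[ y ] Eval O′ (substOracles es e) xs (suc y)
    evalSubst∃ (y , d) = y , evalSubst d

    evalSubstAll : ∀ {es′ : Vec (Prog q n) m} {xs ys} → EvalAll O xs es′ ys →
                   EvalAll O′ xs (substOraclesAll es es′) ys
    evalSubstAll []       = []
    evalSubstAll (d ∷ ds) = evalSubst d ∷ evalSubstAll ds

oraclePrograms : {fs : Vec Baire q} → All Computable fs → Vec (Prog 0 1) q
oraclePrograms []             = []
oraclePrograms ((e , _) ∷ cs) = e ∷ oraclePrograms cs

run-oraclePrograms : {fs : Vec Baire q} (cs : All Computable fs) →
  ∀ i x → Eval [] (lookup (oraclePrograms cs) i) (x ∷ []) (lookup fs i x)
run-oraclePrograms ((_ , computes) ∷ _) zero    x = computes x
run-oraclePrograms (_ ∷ cs)             (suc i) x = run-oraclePrograms cs i x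

constants : Vec ℕ m → Substitution q m n
constants []       = []ˢ
constants (k ∷ ks) = constᴿ k ∷ˢ constants ks

run-constants : ∀ (ks : Vec ℕ m) {O : Vec Baire q} {xs : Vec ℕ n} →
                EvalAll O xs (programs (constants ks)) ks
run-constants []           = []
run-constants (k ∷ ks) {O} {xs} = run-constant k ∷ run-constants ks
  where
  run-constant : ∀ k → Eval O (program (constᴿ k)) xs k
  run-constant zero    = zero
  run-constant (suc k) = comp (run-constant k ∷ []) suc

-- Substituting programs for the oracles and constants for the number parameters leaves a unary
-- program without oracles. Hence `η` sends computable instances to computable ones.
computes⇒computable : {e : Prog q (suc p)} {x : Tuple p q} {f : Baire} →
                      All Computable (funs x) → Computes e x f → Computable f
computes⇒computable {e = e} {tuple ns fs} cs computes =
  comp (substOracles (oraclePrograms cs) e) (proj 0F ∷ programs (constants ns)) ,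
  λ n → comp (proj 0F ∷ run-constants ns) (evalSubst (run-oraclePrograms cs) (computes n))

pointwise-mapˡ : {A B C : Set} {R : A → C → Set} {S : B → C → Set} {f : A → B} →
                 (∀ {x y} → R x y → S (f x) y) →
                 {xs : Vec A n} {ys : Vec C n} → Pointwise R xs ys → Pointwise S (map f xs) ys
pointwise-mapˡ f []       = []
pointwise-mapˡ f (r ∷ rs) = f r ∷ pointwise-mapˡ f rs

evalOracles : ∀ {O : Vec Baire q} {ns : Vec ℕ p} (ρ : Fin q′ → Fin q) (fs : Vec Baire q′) →
              (∀ i → lookup O (ρ i) ≡ lookup fs i) →
              Pointwise (λ e f → Computes e (tuple ns O) f)
                        (tabulate λ i → comp (oracle (ρ i)) (proj 0F ∷ [])) fs
evalOracles ρ []       eq = []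
evalOracles ρ (f ∷ fs) eq =
  (λ n → comp (proj 0F ∷ []) (subst (λ g → Eval _ _ _ (g n)) (eq 0F) (oracle (ρ 0F)))) ∷
  evalOracles (λ i → ρ (suc i)) fs (λ i → eq (suc i))

withOracle : Baire → Tuple p q → Tuple p (suc q)
withOracle α (tuple ns fs) = tuple ns (α ∷ fs)

-- The identity on instances, computed in the presence of a witness as first oracle. It serves
-- translations back to the original formula, whose leaves are about the instance itself.
forgetOracle : Functional p (suc q) p q
forgetOracle = record
  { numProgs = projs id
  ; funProgs = tabulate λ i → comp (oracle (suc i)) (proj 0F ∷ [])
  }

maps-forgetOracle : ∀ α (x : Tuple p q) → Maps forgetOracle (withOracle α x) x
maps-forgetOracle α (tuple ns fs) =
  evalProjs id ns (λ _ → refl) , evalOracles suc fs (λ _ → refl)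

shiftOracles : Prog q n → Prog (suc q) n
shiftOracles = substOracles (tabulate λ i → oracle (suc i))

evalShift : ∀ {O : Vec Baire q} {α} {e : Prog q n} {xs y} →
            Eval O e xs y → Eval (α ∷ O) (shiftOracles e) xs y
evalShift {O = O} {α} = evalSubst λ i x →
  subst (λ e → Eval (α ∷ O) e (x ∷ []) (lookup O i x)) (sym (lookup∘tabulate _ i))
    (oracle (suc i))

-- The same functional in the presence of a witness as first oracle, for translations whose leaves
-- are about the image of the instance.
underOracle : Functional p q p′ q′ → Functional p (suc q) p′ q′
underOracle η = record
  { numProgs = map shiftOracles (numProgs η)
  ; funProgs = map shiftOracles (funProgs η)
  }

maps-underOracle : ∀ {η : Functional p q p′ q′} α x {y} →
                   Maps η x y → Maps (underOracle η) (withOracle α x) y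
maps-underOracle α (tuple ns fs) (nums↦ , funs↦) =
  pointwise-mapˡ (evalShift {O = fs}) nums↦ ,
  pointwise-mapˡ (λ computes n → evalShift {O = fs} (computes n)) funs↦

underNumber : Functional p q p′ q′ → Functional (suc p) q (suc p′) q′
underNumber η = record
  { numProgs = proj 0F ∷ map (λ e → comp e (projs suc)) (numProgs η)
  ; funProgs = map (λ e → comp e (proj 0F ∷ projs (λ i → suc (suc i)))) (funProgs η)
  }

maps-underNumber : ∀ {η : Functional p q p′ q′} n {x y} →
                   Maps η x y → Maps (underNumber η) (n ▸ x) (n ▸ y)
maps-underNumber n {tuple ns fs} (nums↦ , funs↦) =
  proj 0F ∷ pointwise-mapˡ (comp (evalProjs suc ns λ _ → refl)) nums↦ ,
  pointwise-mapˡ (λ computes k →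
    comp (proj 0F ∷ evalProjs (λ i → suc (suc i)) ns λ _ → refl) (computes k)) funs↦

-- Programs for the encoding of tuples

consProgram : Prog q n → Prog q (suc n) → Prog q (suc n)
-- The recursion is a mere case distinction: the step keeps the predecessor and drops the value
-- computed there.
consProgram e f = prec e (comp f (proj 0F ∷ projs (λ i → suc (suc i))))

run-consProgram : ∀ {O : Vec Baire q} {ns : Vec ℕ n} {e f t g} →
  Eval O e ns t → (∀ k → Eval O f (k ∷ ns) (g k)) →
  ∀ k → Eval O (consProgram e f) (k ∷ ns) ((t ◂ g) k)
run-consProgram d ds zero    = prec-zero d
run-consProgram {ns = ns} d ds (suc k) = prec-suc (run-consProgram d ds k)
  (comp (proj 0F ∷ evalProjs (λ i → suc (suc i)) ns λ _ → refl) (ds k))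

parity half : ℕ → ℕ
parity zero    = 0
parity (suc n) = 1 ∸ parity n
half zero    = 0
half (suc n) = parity n + half n

parityᴿ : Recursive q n → Recursive q n
parityᴿ f = par [ f ∷ˢ []ˢ ]
  where
  par : Recursive q 1
  par = computing (precᴿ zeroᴿ (constᴿ 1 ∸ᴿ varᴿ 1F)) (λ { _ (n ∷ []) → parity n })
          λ { _ (n ∷ []) → fold-parity n }
    where
    fold-parity : ∀ n → fold 0 (λ _ b → 1 ∸ b) n ≡ parity n
    fold-parity zero    = refl
    fold-parity (suc n) = cong (1 ∸_) (fold-parity n)

halfᴿ : Recursive q n → Recursive q n
halfᴿ f = hal [ f ∷ˢ []ˢ ]
  where
  hal : Recursive q 1
  hal = computing (precᴿ zeroᴿ (parityᴿ (varᴿ 0F) +ᴿ varᴿ 1F)) (λ { _ (n ∷ []) → half n })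
          λ { _ (n ∷ []) → fold-half n }
    where
    fold-half : ∀ n → fold 0 (λ k h → parity k + h) n ≡ half n
    fold-half zero    = refl
    fold-half (suc n) = cong (parity n +_) (fold-half n)

parity-cases : ∀ n → parity n ≡ 0 ⊎ parity n ≡ 1
parity-cases zero = inj₁ refl
parity-cases (suc n) with parity n | parity-cases n
... | _ | inj₁ refl = inj₂ refl
... | _ | inj₂ refl = inj₁ refl

-- Going from `n` to `suc n` exchanges the two functions and shifts one of them by `tail`, in step
-- with the recursions for `parity` and `half`.
interleave-parity : ∀ f g n →
  ifNonZero (parity n) (g (half n)) (f (half n)) ≡ interleave f g n
interleave-parity f g zero = refl
interleave-parity f g (suc n)
  with parity n | parity-cases n | interleave-parity g (tail f) n
... | _ | inj₁ refl | ih = ih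
... | _ | inj₂ refl | ih = ih

interleaveProgram : Prog q (suc n) → Prog q (suc n) → Prog q (suc n)
interleaveProgram e f =
  comp (program (ifᴿ varᴿ 0F then varᴿ 1F else varᴿ 2F))
    (program (parityᴿ (varᴿ 0F)) ∷ comp f halved ∷ comp e halved ∷ [])
  where
  halved = program (halfᴿ (varᴿ 0F)) ∷ projs suc

run-interleaveProgram : ∀ {x : Tuple n q} {e e′ f f′} → Computes e x f → Computes e′ x f′ →
                        Computes (interleaveProgram e e′) x (interleave f f′)
run-interleaveProgram {x = tuple ns O} {f = f} {f′} ds ds′ n =
  subst (Eval _ _ _) (interleave-parity f f′ n)
    (comp (run (parityᴿ (varᴿ 0F)) O _ ∷ comp halved (ds′ _) ∷ comp halved (ds _) ∷ [])
          (run (ifᴿ varᴿ 0F then varᴿ 1F else varᴿ 2F) O _))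
  where
  halved : EvalAll O (n ∷ ns) (program (halfᴿ (varᴿ 0F)) ∷ projs suc) (half n ∷ ns)
  halved = run (halfᴿ (varᴿ 0F)) O _ ∷ evalProjs suc ns λ _ → refl

joinProgram : Vec (Prog q (suc n)) m → Prog q (suc n)
joinProgram []           = zero
joinProgram (e ∷ [])     = e
joinProgram (e ∷ f ∷ fs) = interleaveProgram e (joinProgram (f ∷ fs))

run-joinProgram : ∀ {x : Tuple n q} {es : Vec (Prog q (suc n)) m} {fs : Vec Baire m} →
  Pointwise (λ e f → Computes e x f) es fs → Computes (joinProgram es) x (joinFuns fs)
run-joinProgram []           = λ _ → zero
run-joinProgram (d ∷ [])     = d
run-joinProgram (d ∷ c ∷ cs) = run-interleaveProgram d (run-joinProgram (c ∷ cs))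

encodeProgram : Vec (Prog q n) m → Vec (Prog q (suc n)) k → Prog q (suc n)
encodeProgram []       fs = joinProgram fs
encodeProgram (e ∷ es) fs = consProgram e (encodeProgram es fs)

run-encodeProgram : ∀ {η : Functional p q p′ q′} {x y} → Maps η x y →
  Computes (encodeProgram (numProgs η) (funProgs η)) x (encode y)
run-encodeProgram {x = tuple ns O} (ds , cs) = go ds cs
  where
  go : ∀ {p′ q′} {es : Vec (Prog _ _) p′} {ms : Vec ℕ p′}
         {fs : Vec (Prog _ _) q′} {gs : Vec Baire q′} →
       EvalAll O ns es ms → Pointwise (λ e f → Computes e (tuple ns O) f) fs gs →
       Computes (encodeProgram es fs) (tuple ns O) (encode (tuple ms gs))
  go []       cs = run-joinProgram cs
  go (d ∷ ds) cs = run-consProgram d (go ds cs)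

-- Witnesses and Skolem functions

∀∃∀ ∃∀∃ : Pattern
∀∃∀ = `∀ ∷ `∃ ∷ `∀ ∷ []
∃∀∃ = `∃ ∷ `∀ ∷ `∃ ∷ []

∀∃∀-formula : Bounded (suc (suc (suc p))) q → Formula ∀∃∀ p q
∀∃∀-formula θ = quant `∀ (quant `∃ (quant `∀ (matrix θ)))

∃∀∃-formula : Bounded (suc (suc (suc p))) q → Formula ∃∀∃ p q
∃∀∃-formula θ = quant `∃ (quant `∀ (quant `∃ (matrix θ)))

-- A witness consists of its choices at the existential quantifiers and of encoded tuples at the
-- leaves. The leaves can be recomputed from the choices and the instance, so translating witnesses
-- comes down to translating Skolem functions.
∀∃∀-Skolem : Bounded (suc (suc (suc p))) q → Tuple p q → (ℕ → ℕ) → Set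
∀∃∀-Skolem θ x f = ∀ a c → ⟦ θ ⟧ (c ▸ f a ▸ a ▸ x)

∃∀∃-Skolem : Bounded (suc (suc (suc p))) q → Tuple p q → ℕ → (ℕ → ℕ) → Set
∃∀∃-Skolem θ x a g = ∀ b → ⟦ θ ⟧ (g b ▸ b ▸ a ▸ x)

-- Where a ∀∃∀-witness keeps its value b for a, and an ∃∀∃-witness its value c for b.
choice∀∃ choice∃∀ : Baire → ℕ → ℕ
choice∀∃ α a = α (pair a 0)
choice∃∀ α b = α (suc (pair b 0))

⊩⇒∀∃∀-Skolem : ∀ {θ} {x : Tuple p q} {α} → α ⊩ ∀∃∀-formula θ [ x ] →
               ∀∃∀-Skolem θ x (choice∀∃ α)
⊩⇒∀∃∀-Skolem w a c = proj₂ (w a c)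

⊩⇒∃∀∃-Skolem : ∀ {θ} {x : Tuple p q} {α} → α ⊩ ∃∀∃-formula θ [ x ] →
               ∃∀∃-Skolem θ x (α 0) (choice∃∀ α)
⊩⇒∃∀∃-Skolem w b = proj₂ (w b)

-- Programs that assemble witnesses from Skolem functions

fst₀ snd₀ : Prog q (suc n)
fst₀ = program (fstᴿ (varᴿ 0F))
snd₀ = program (sndᴿ (varᴿ 0F))

run-fst₀ : ∀ (O : Vec Baire q) n (ns : Vec ℕ p) → Eval O fst₀ (n ∷ ns) (fst n)
run-fst₀ O n ns = run (fstᴿ (varᴿ 0F)) O (n ∷ ns)

run-snd₀ : ∀ (O : Vec Baire q) n (ns : Vec ℕ p) → Eval O snd₀ (n ∷ ns) (snd n)
run-snd₀ O n ns = run (sndᴿ (varᴿ 0F)) O (n ∷ ns)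

leafProgram : Functional p q p′ q′ → Prog q (suc (suc (suc (suc p))))
leafProgram η = encodeProgram (numProgs η₃) (funProgs η₃)
  where η₃ = underNumber (underNumber (underNumber η))

run-leafProgram : ∀ {η : Functional p q p′ q′} {x y} → Maps η x y → ∀ c b a →
                  Computes (leafProgram η) (c ▸ b ▸ a ▸ x) (encode (c ▸ b ▸ a ▸ y))
run-leafProgram {η = η} η↦ c b a =
  run-encodeProgram {η = underNumber (underNumber (underNumber η))}
    (maps-underNumber c (maps-underNumber b (maps-underNumber a η↦)))

∀∃∀-program : Functional p q p′ q′ → Prog q (suc p) → Prog q (suc p)
∀∃∀-program {p} {q} η e = comp block (snd₀ ∷ fst₀ ∷ projs suc)
  where
  block : Prog q (suc (suc p))
  -- The block for `a` holds `f a`, followed by all leaves: entry `pair c j` of its tail is entry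
  -- `j` of the leaf for `c`.
  block = consProgram e
    (comp (leafProgram η) (snd₀ ∷ fst₀ ∷ comp e (projs suc) ∷ projs suc))

module _ {η : Functional p q p′ q′} {x : Tuple p q} {y : Tuple p′ q′} (η↦ : Maps η x y) where
  private
    O  = funs x
    ns = nums x

  module _ {e : Prog q (suc p)} {f : Baire} (computes : Computes e x f) where
    ∀∃∀-blocks : ℕ → Baire
    ∀∃∀-blocks a = f a ◂ λ m → encode (fst m ▸ f a ▸ a ▸ y) (snd m)

    ∀∃∀-witness : Baire
    ∀∃∀-witness n = ∀∃∀-blocks (fst n) (snd n)

    run-∀∃∀-program : Computes (∀∃∀-program η e) x ∀∃∀-witness
    run-∀∃∀-program n =
      comp (run-snd₀ O n ns ∷ run-fst₀ O n ns ∷ evalProjs suc ns λ _ → refl)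
        (run-consProgram (computes a)
          (λ m → comp
            (run-snd₀ O m (a ∷ ns) ∷ run-fst₀ O m (a ∷ ns) ∷
             comp (evalProjs suc (a ∷ ns) λ _ → refl) (computes a) ∷
             evalProjs suc (a ∷ ns) λ _ → refl)
            (run-leafProgram η↦ (fst m) (f a) a (snd m)))
          (snd n))
      where a = fst n

    ∀∃∀-witness-row : ∀ a k → row ∀∃∀-witness a k ≡ ∀∃∀-blocks a k
    ∀∃∀-witness-row a k = cong₂ ∀∃∀-blocks (fst-pair a k) (snd-pair a k)

    Skolem⇒∀∃∀-witness : ∀ {θ} → ∀∃∀-Skolem θ y f → ∀∃∀-witness ⊩ ∀∃∀-formula θ [ y ]
    -- Entry 0 of the row for `a` is the number chosen for `b`; it has to become `f a` before the
    -- leaves can be compared.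
    Skolem⇒∀∃∀-witness {θ} s a c rewrite ∀∃∀-witness-row a 0 =
      (λ j → trans (∀∃∀-witness-row a (suc (pair c j)))
                   (cong₂ (λ c′ → encode (c′ ▸ f a ▸ a ▸ y)) (fst-pair c j) (snd-pair c j))) ,
      s a c

∃∀∃-program : Functional p q p′ q′ → Prog q p → Prog q (suc p) → Prog q (suc p)
∃∀∃-program {p} {q} η d e = consProgram d (comp block (snd₀ ∷ fst₀ ∷ projs suc))
  where
  block : Prog q (suc (suc p))
  -- The last quantifier is existential, so the block for `b` holds `g b` and a single leaf, without
  -- a further pairing.
  block = consProgram e
    (comp (leafProgram η)
      (proj 0F ∷ comp e (projs suc) ∷ proj 1F ∷
       comp d (projs λ i → suc (suc i)) ∷ projs λ i → suc (suc i)))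

module _ {η : Functional p q p′ q′} {x : Tuple p q} {y : Tuple p′ q′} (η↦ : Maps η x y) where
  private
    O  = funs x
    ns = nums x

  module _ {d : Prog q p} {a : ℕ} (d↦ : Eval O d ns a)
           {e : Prog q (suc p)} {g : Baire} (computes : Computes e x g) where
    ∃∀∃-blocks : ℕ → Baire
    ∃∀∃-blocks b = g b ◂ encode (g b ▸ b ▸ a ▸ y)

    ∃∀∃-witness : Baire
    ∃∀∃-witness = a ◂ λ m → ∃∀∃-blocks (fst m) (snd m)

    run-∃∀∃-program : Computes (∃∀∃-program η d e) x ∃∀∃-witness
    run-∃∀∃-program = run-consProgram d↦ λ m →
      let b = fst m in
      comp (run-snd₀ O m ns ∷ run-fst₀ O m ns ∷ evalProjs suc ns λ _ → refl)
        (run-consProgram (computes b)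
          (λ j → comp
            (proj 0F ∷ comp (evalProjs suc (b ∷ ns) λ _ → refl) (computes b) ∷ proj 1F ∷
             comp (evalProjs _ ns λ _ → refl) d↦ ∷ evalProjs _ ns λ _ → refl)
            (run-leafProgram η↦ (g b) b a j))
          (snd m))

    ∃∀∃-witness-row : ∀ b k → row (tail ∃∀∃-witness) b k ≡ ∃∀∃-blocks b k
    ∃∀∃-witness-row b k = cong₂ ∃∀∃-blocks (fst-pair b k) (snd-pair b k)

    Skolem⇒∃∀∃-witness : ∀ {θ} → ∃∀∃-Skolem θ y a g → ∃∀∃-witness ⊩ ∃∀∃-formula θ [ y ]
    Skolem⇒∃∀∃-witness {θ} s b rewrite ∃∀∃-witness-row b 0 =
      (λ j → ∃∀∃-witness-row b (suc j)) , s b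

-- Reductions in terms of Skolem functions

True⇒∀∃∀-Skolem : ∀ {θ} {x : Tuple p q} → True (∀∃∀-formula θ) x →
                  ∃[ α ] ∀∃∀-Skolem θ x (choice∀∃ α)
-- The value for `a` is stored at every place `pair a k`, of which `choice∀∃` reads `pair a 0`.
-- Nothing requires this `α` to be computable.
True⇒∀∃∀-Skolem {θ = θ} {x} t = (λ n → proj₁ (t (fst n))) , λ a c →
  subst (λ a′ → ⟦ θ ⟧ (c ▸ proj₁ (t a′) ▸ a ▸ x)) (sym (fst-pair a 0)) (proj₂ (t a) c)

True⇒∃∀∃-Skolem : ∀ {θ} {x : Tuple p q} → True (∃∀∃-formula θ) x →
                  ∃[ α ] ∃∀∃-Skolem θ x (α 0) (choice∃∀ α)
True⇒∃∀∃-Skolem {θ = θ} {x} (a , t) = (a ◂ λ m → proj₁ (t (fst m))) , λ b →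
  subst (λ b′ → ⟦ θ ⟧ (proj₁ (t b′) ▸ b ▸ a ▸ x)) (sym (fst-pair b 0)) (proj₂ (t b))

-- The subscript `₋` marks translations from `θ` to `θ′`, and `₊` those back; the witness is the
-- first oracle. Since `α` is arbitrary and truth yields Skolem functions, the same four
-- translations also give the equivalences of truth.
record Reduction (θ : Bounded (suc (suc (suc p))) q) (D : Tuple p q → Set)
                 (θ′ : Bounded (suc (suc (suc p′))) q′) (D′ : Tuple p′ q′ → Set) : Set where
  field
    η       : Functional p q p′ q′
    ∀∃₋ ∀∃₊ : Recursive (suc q) (suc p)
    ∃₋ ∃₊   : Recursive (suc q) p
    ∃∀₋ ∃∀₊ : Recursive (suc q) (suc p)
    image   : Tuple p q → Tuple p′ q′
    maps    : ∀ x → Maps η x (image x)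
    domain  : ∀ {x} → D x → D′ (image x)

  at : Recursive (suc q) (suc p) → Baire → Tuple p q → ℕ → ℕ
  at f α x n = apply f (α ∷ funs x) (n ∷ nums x)

  value : Recursive (suc q) p → Baire → Tuple p q → ℕ
  value f α x = apply f (α ∷ funs x) (nums x)

  field
    ∀∃∀₋ : ∀ {x} → D x → ∀ α → ∀∃∀-Skolem θ x (choice∀∃ α) →
           ∀∃∀-Skolem θ′ (image x) (at ∀∃₋ α x)
    ∀∃∀₊ : ∀ {x} → D x → ∀ α → ∀∃∀-Skolem θ′ (image x) (choice∀∃ α) →
           ∀∃∀-Skolem θ x (at ∀∃₊ α x)
    ∃∀∃₋ : ∀ {x} → D x → ∀ α → ∃∀∃-Skolem (`¬ θ) x (α 0) (choice∃∀ α) →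
           ∃∀∃-Skolem (`¬ θ′) (image x) (value ∃₋ α x) (at ∃∀₋ α x)
    ∃∀∃₊ : ∀ {x} → D x → ∀ α → ∃∀∃-Skolem (`¬ θ′) (image x) (α 0) (choice∃∀ α) →
           ∃∀∃-Skolem (`¬ θ) x (value ∃₊ α x) (at ∃∀₊ α x)

∀∃∀-problem : Bounded (suc (suc (suc p))) q → (Tuple p q → Set) → Problem ∀∃∀ p q
∀∃∀-problem θ D = record { formula = ∀∃∀-formula θ ; Domain = D }

Reduction⇒≤dm : ∀ {θ : Bounded (suc (suc (suc p))) q} {D}
                  {θ′ : Bounded (suc (suc (suc p′))) q′} {D′} →
                Reduction θ D θ′ D′ → ∀∃∀-problem θ D ≤dm ∀∃∀-problem θ′ D′
Reduction⇒≤dm {p} {q} {θ = θ} {D} {θ′} {D′} ρ =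
  η ,
  -- The leaves of the first translation are about `image x`, those of the second about `x`.
  (∀∃∀-program (underOracle η) (program ∀∃₋) , ∀∃∀-program forgetOracle (program ∀∃₊) ,
   λ x (computable , d) → image x , maps x , instance′ x computable d ,
   mk⇔
     (λ t → let α , s = True⇒∀∃∀-Skolem {θ = θ} t in λ a → _ , ∀∃∀₋ d α s a)
     (λ t → let α , s = True⇒∀∃∀-Skolem {θ = θ′} t in λ a → _ , ∀∃∀₊ d α s a) ,
   (λ α w → _ , run-∀∃∀-program (maps₋ α x) (run₁ ∀∃₋ α x) ,
      Skolem⇒∀∃∀-witness (maps₋ α x) (run₁ ∀∃₋ α x) {θ′}
        (∀∃∀₋ d α (⊩⇒∀∃∀-Skolem {θ = θ} {α = α} w))) ,
   (λ α w → _ , run-∀∃∀-program (maps₊ α x) (run₁ ∀∃₊ α x) ,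
      Skolem⇒∀∃∀-witness (maps₊ α x) (run₁ ∀∃₊ α x) {θ}
        (∀∃∀₊ d α (⊩⇒∀∃∀-Skolem {θ = θ′} {α = α} w)))) ,
  (∃∀∃-program (underOracle η) (program ∃₋) (program ∃∀₋) ,
   ∃∀∃-program forgetOracle (program ∃₊) (program ∃∀₊) ,
   λ x (computable , d) → image x , maps x , instance′ x computable d ,
   mk⇔
     (λ t → let α , s = True⇒∃∀∃-Skolem {θ = `¬ θ} t in _ , λ b → _ , ∃∀∃₋ d α s b)
     (λ t → let α , s = True⇒∃∀∃-Skolem {θ = `¬ θ′} t in _ , λ b → _ , ∃∀∃₊ d α s b) ,
   (λ α w → _ , run-∃∀∃-program (maps₋ α x) (run₀ ∃₋ α x) (run₁ ∃∀₋ α x) ,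
      Skolem⇒∃∀∃-witness (maps₋ α x) (run₀ ∃₋ α x) (run₁ ∃∀₋ α x) {`¬ θ′}
        (∃∀∃₋ d α (⊩⇒∃∀∃-Skolem {θ = `¬ θ} {α = α} w))) ,
   (λ α w → _ , run-∃∀∃-program (maps₊ α x) (run₀ ∃₊ α x) (run₁ ∃∀₊ α x) ,
      Skolem⇒∃∀∃-witness (maps₊ α x) (run₀ ∃₊ α x) (run₁ ∃∀₊ α x) {`¬ θ}
        (∃∀∃₊ d α (⊩⇒∃∀∃-Skolem {θ = `¬ θ′} {α = α} w))))
  where
  open Reduction ρ

  maps₋ : ∀ α x → Maps (underOracle η) (withOracle α x) (image x)
  maps₋ α x = maps-underOracle {η = η} α x (maps x)

  maps₊ : ∀ α x → Maps forgetOracle (withOracle α x) x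
  maps₊ = maps-forgetOracle

  run₁ : ∀ f α x → Computes (program f) (withOracle α x) (at f α x)
  run₁ f α x n = run f (α ∷ funs x) (n ∷ nums x)

  run₀ : ∀ f α x → Eval (α ∷ funs x) (program f) (nums x) (value f α x)
  run₀ f α x = run f (α ∷ funs x) (nums x)

  instance′ : ∀ x → All Computable (funs x) → D x → IsInstance (∀∃∀-problem θ′ D′) (image x)
  instance′ x computable d = allComputable (proj₂ (maps x)) , domain d
    where
    allComputable : ∀ {k} {es : Vec (Prog q (suc p)) k} {fs : Vec Baire k} →
      Pointwise (λ e f → Computes e x f) es fs → All Computable fs
    allComputable []       = []
    allComputable (c ∷ cs) = computes⇒computable {x = x} computable c ∷ allComputable cs

-- Completeness of the formula saying that x(a, b, c) = 0

zeroMatrix : Bounded 3 1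
zeroMatrix = 0F · ⟪ var 2F , ⟪ var 1F , var 0F ⟫ ⟫ `≡ zero

-- The image of `x` is the characteristic function of the failure of `θ`, so both sides have the
-- same Skolem functions and every translation copies them. With `D` arbitrary, this also covers the
-- reduction from `Compl`.
zeroReduction : ∀ (θ : Bounded (suc (suc (suc p))) q) D →
                Reduction θ D zeroMatrix (λ _ → ⊤)
zeroReduction {p} {q} θ D = record
  { η      = record { numProgs = [] ; funProgs = program fails ∷ [] }
  ; ∀∃₋ = choiceᴿ ; ∀∃₊ = choiceᴿ
  ; ∃₋ = firstᴿ ; ∃₊ = firstᴿ ; ∃∀₋ = choice′ᴿ ; ∃∀₊ = choice′ᴿ
  ; image  = λ x → tuple [] (failure x ∷ [])
  ; maps   = λ x → [] , (λ n → run fails (funs x) (n ∷ nums x)) ∷ []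
  ; domain = λ _ → tt
  ; ∀∃∀₋ = λ {x} _ α s a c → holds⇒zero x c _ a (s a c)
  ; ∀∃∀₊ = λ {x} _ α s a c → zero⇒holds x c _ a (s a c)
  ; ∃∀∃₋ = λ {x} _ α s b z → s b (zero⇒holds x _ b _ z)
  ; ∃∀∃₊ = λ {x} _ α s b h → s b (holds⇒zero x _ b _ h)
  }
  where
  fails : Recursive q (suc p)
  fails = χ (`¬ θ) [ sndᴿ (sndᴿ (varᴿ 0F)) ∷ˢ fstᴿ (sndᴿ (varᴿ 0F)) ∷ˢ fstᴿ (varᴿ 0F) ∷ˢ dropˢ ]

  failure : Tuple p q → Baire
  failure x n = apply fails (funs x) (n ∷ nums x)

  choiceᴿ choice′ᴿ : Recursive (suc q) (suc p)
  choiceᴿ  = oracleᴿ 0F (pairᴿ (varᴿ 0F) zeroᴿ)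
  choice′ᴿ = oracleᴿ 0F (sucᴿ (pairᴿ (varᴿ 0F) zeroᴿ))

  firstᴿ : Recursive (suc q) p
  firstᴿ = oracleᴿ 0F zeroᴿ

  failure-decides : ∀ x c b a → Decides (¬ ⟦ θ ⟧ (c ▸ b ▸ a ▸ x)) (failure x (pair a (pair b c)))
  failure-decides x c b a
    rewrite fst-pair a (pair b c) | snd-pair a (pair b c) | fst-pair b c | snd-pair b c =
    χ-decides (`¬ θ) (funs x) (c ∷ b ∷ a ∷ nums x)

  holds-decides : ∀ x c b a → Decides (⟦ θ ⟧ (c ▸ b ▸ a ▸ x))
                                      (apply (χ θ) (funs x) (c ∷ b ∷ a ∷ nums x))
  holds-decides x c b a = χ-decides θ (funs x) (c ∷ b ∷ a ∷ nums x)

  holds⇒zero : ∀ x c b a → ⟦ θ ⟧ (c ▸ b ▸ a ▸ x) → failure x (pair a (pair b c)) ≡ 0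
  holds⇒zero x c b a h with failure x (pair a (pair b c)) | failure-decides x c b a
  ... | _ | true ¬h = contradiction h ¬h
  ... | _ | false _   = refl

  -- A value 0 refutes the negation of `θ`; the double negation is removed by deciding `θ` itself.
  zero⇒holds : ∀ x c b a → failure x (pair a (pair b c)) ≡ 0 → ⟦ θ ⟧ (c ▸ b ▸ a ▸ x)
  zero⇒holds x c b a z
    with failure x (pair a (pair b c)) | failure-decides x c b a
       | apply (χ θ) (funs x) (c ∷ b ∷ a ∷ nums x) | holds-decides x c b a
  ... | _ | _      | _ | true h = h
  ... | _ | false ¬¬h | _ | false ¬h = contradiction ¬h ¬¬h

zeroMatrix-strictlyDicomplete : StrictlyDicomplete (∀∃∀-formula zeroMatrix)
zeroMatrix-strictlyDicomplete (quant `∀ (quant `∃ (quant `∀ (matrix θ)))) =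
  Reduction⇒≤dm (zeroReduction θ (λ _ → ⊤))

Compl-≤dm-zeroMatrix : Compl ≤dm unrestricted (∀∃∀-formula zeroMatrix)
Compl-≤dm-zeroMatrix = Reduction⇒≤dm (zeroReduction complMatrix BoundedPosetCode)

-- The poset

-- The second index of P is redundant and R takes all kinds from 6 on, so that
-- every number is the code of exactly one element.
data Element : Set where
  top bot     : Element
  P Q T Z U V : ℕ → ℕ → Element
  R           : ℕ → ℕ → ℕ → Element

-- The two successors keep 0 and 1 free for `top` and `bot`.
mid : ℕ → ℕ → ℕ → ℕ
mid k a b = suc (suc (pair k (pair a b)))

code : Element → ℕ
code top       = 0
code bot       = 1
code (P a b)   = mid 0 a b
code (Q a b)   = mid 1 a b
code (T a b)   = mid 2 a b
code (Z a b)   = mid 3 a b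
code (U a b)   = mid 4 a b
code (V a b)   = mid 5 a b
code (R a b c) = mid (6 + c) a b

element : ℕ → ℕ → ℕ → Element
element 0 a b = P a b
element 1 a b = Q a b
element 2 a b = T a b
element 3 a b = Z a b
element 4 a b = U a b
element 5 a b = V a b
element (suc (suc (suc (suc (suc (suc c)))))) a b = R a b c

kind index₁ index₂ : ℕ → ℕ
kind   e = fst (pred (pred e))
index₁ e = fst (snd (pred (pred e)))
index₂ e = snd (snd (pred (pred e)))

decode : ℕ → Element
decode 0             = top
decode 1             = bot
decode (suc (suc n)) = element (fst n) (fst (snd n)) (snd (snd n))

kind-mid : ∀ k a b → kind (mid k a b) ≡ k
kind-mid k a b = fst-pair k (pair a b)

index₁-mid : ∀ k a b → index₁ (mid k a b) ≡ a
index₁-mid k a b = trans (cong fst (snd-pair k (pair a b))) (fst-pair a b)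

index₂-mid : ∀ k a b → index₂ (mid k a b) ≡ b
index₂-mid k a b = trans (cong snd (snd-pair k (pair a b))) (snd-pair a b)

decode-mid : ∀ k a b → decode (mid k a b) ≡ element k a b
decode-mid k a b
  rewrite fst-pair k (pair a b) | snd-pair k (pair a b) | fst-pair a b | snd-pair a b = refl

decode-code : ∀ E → decode (code E) ≡ E
decode-code top       = refl
decode-code bot       = refl
decode-code (P a b)   = decode-mid 0 a b
decode-code (Q a b)   = decode-mid 1 a b
decode-code (T a b)   = decode-mid 2 a b
decode-code (Z a b)   = decode-mid 3 a b
decode-code (U a b)   = decode-mid 4 a b
decode-code (V a b)   = decode-mid 5 a b
decode-code (R a b c) = decode-mid (6 + c) a b

code-element : ∀ k a b → code (element k a b) ≡ mid k a b
code-element 0 a b = refl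
code-element 1 a b = refl
code-element 2 a b = refl
code-element 3 a b = refl
code-element 4 a b = refl
code-element 5 a b = refl
code-element (suc (suc (suc (suc (suc (suc c)))))) a b = refl

code-decode : ∀ e → code (decode e) ≡ e
code-decode 0 = refl
code-decode 1 = refl
code-decode (suc (suc n)) = trans (code-element _ _ _)
  (cong (λ m → suc (suc m)) (trans (cong (pair (fst n)) (pair-fst-snd (snd n))) (pair-fst-snd n)))

decode-injective : ∀ {e f} → decode e ≡ decode f → e ≡ f
decode-injective {e} {f} eq =
  trans (sym (code-decode e)) (trans (cong code eq) (code-decode f))

code-of : ∀ {e E} → decode e ≡ E → e ≡ code E
code-of {e} eq = trans (sym (code-decode e)) (cong code eq)

-- H a b c stands for x(a, b, c) ≠ 0.
module Order (H : ℕ → ℕ → ℕ → Set) where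

  infix 4 _⊏_ _⊑_

  -- The inequalities create the complements: `T a _` lies below `P a _` and below every `Q` except
  -- the `Q a _`, while `t<z` and `v<u` each leave out just the pair that is to be complementary.
  data _⊏_ : Element → Element → Set where
    t<p : ∀ {a b b′} → T a b ⊏ P a b′
    t<q : ∀ {a b a′ b′} → a ≢ a′ → T a b ⊏ Q a′ b′
    t<z : ∀ {a b a′ b′} → pair a b ≢ pair a′ b′ → T a b ⊏ Z a′ b′
    t<u : ∀ {a b a′ b′} → T a b ⊏ U a′ b′
    t<r : ∀ {a b a′ b′ c} → T a b ⊏ R a′ b′ c
    v<u : ∀ {a b a′ b′} → pair a b ≢ pair a′ b′ → V a b ⊏ U a′ b′
    p<u : ∀ {a b a′ b′} → P a b ⊏ U a′ b′
    p<r : ∀ {a b b′ c} → H a b c → P a b′ ⊏ R a b c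
    q<r : ∀ {a b c} → H a b c → Q a b ⊏ R a b c

  data _⊑_ : Element → Element → Set where
    ⊑-top  : ∀ {E} → E ⊑ top
    bot-⊑  : ∀ {E} → bot ⊑ E
    ⊑-refl : ∀ {E} → E ⊑ E
    ⊏⇒⊑    : ∀ {E F} → E ⊏ F → E ⊑ F

  -- Only a `P` or a `Q` can stand in the middle of a chain. The element below it is a `T`, and
  -- every `T` lies below all `U` and all `R`.
  ⊏-trans : Transitive _⊏_
  ⊏-trans t<p     p<u     = t<u
  ⊏-trans t<p     (p<r _) = t<r
  ⊏-trans (t<q _) (q<r _) = t<r

  ⊏-asym : ∀ {E F} → E ⊏ F → ¬ F ⊏ E
  ⊏-asym t<p ()
  ⊏-asym (t<q _) ()
  ⊏-asym (t<z _) ()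
  ⊏-asym t<u ()
  ⊏-asym t<r ()
  ⊏-asym (v<u _) ()
  ⊏-asym p<u ()
  ⊏-asym (p<r _) ()
  ⊏-asym (q<r _) ()

  ⊑-trans : Transitive _⊑_
  ⊑-trans _       ⊑-top   = ⊑-top
  ⊑-trans bot-⊑   _       = bot-⊑
  ⊑-trans ⊑-refl  l       = l
  ⊑-trans l       ⊑-refl  = l
  ⊑-trans (⊏⇒⊑ l) (⊏⇒⊑ m) = ⊏⇒⊑ (⊏-trans l m)

  ⊑-antisym : Antisymmetric _≡_ _⊑_
  ⊑-antisym ⊑-top   ⊑-top   = refl
  ⊑-antisym bot-⊑   bot-⊑   = refl
  ⊑-antisym ⊑-refl  _       = refl
  ⊑-antisym l       ⊑-refl  = refl
  ⊑-antisym (⊏⇒⊑ l) (⊏⇒⊑ m) = contradiction m (⊏-asym l)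

  Clash : Element → Element → Element → Set
  Clash E F G = (E ⊑ G × F ⊑ G × G ≢ top) ⊎ (bot ≢ G × G ⊑ E × G ⊑ F)

  -- `V 0 0` suits `Q` and `R`: strictly above a `V` there are only the `U` and `top`, and strictly
  -- below it only `bot`, whereas no `U` lies above a `Q` or an `R`.
  complement : (ℕ → ℕ) → Element → Element
  complement f top       = bot
  complement f bot       = top
  complement f (P a b)   = Q a (f a)
  complement f (Q a b)   = V 0 0
  complement f (T a b)   = Z a b
  complement f (Z a b)   = T a b
  complement f (U a b)   = V a b
  complement f (V a b)   = U a b
  complement f (R a b c) = V 0 0

  Clash-sym : ∀ {E F G} → Clash E F G → Clash F E G
  Clash-sym (inj₁ (l , m , ne)) = inj₁ (m , l , ne)
  Clash-sym (inj₂ (ne , l , m)) = inj₂ (ne , m , l)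

  top-bot-compatible : ∀ {G} → ¬ Clash top bot G
  top-bot-compatible (inj₁ (⊑-top , _ , ne)) = ne refl
  top-bot-compatible (inj₁ (⊑-refl , _ , ne)) = ne refl
  top-bot-compatible (inj₂ (ne , _ , bot-⊑)) = ne refl
  top-bot-compatible (inj₂ (ne , _ , ⊑-refl)) = ne refl

  -- Strictly above `Z a b` there is only `top`, and strictly below `T a b` only `bot`. A clash
  -- would therefore need `T a b ⊑ Z a b`, which `t<z` excludes.
  T-Z-compatible : ∀ {a b G} → ¬ Clash (T a b) (Z a b) G
  T-Z-compatible (inj₁ (_ , ⊑-top , ne)) = ne refl
  T-Z-compatible (inj₁ (⊏⇒⊑ (t<z ne) , ⊑-refl , _)) = ne refl
  T-Z-compatible (inj₂ (ne , bot-⊑ , _)) = ne refl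
  T-Z-compatible (inj₂ (_ , ⊑-refl , ⊏⇒⊑ (t<z ne))) = ne refl

  V-U-compatible : ∀ {a b G} → ¬ Clash (V a b) (U a b) G
  V-U-compatible (inj₁ (_ , ⊑-top , ne)) = ne refl
  V-U-compatible (inj₁ (⊏⇒⊑ (v<u ne) , ⊑-refl , _)) = ne refl
  V-U-compatible (inj₂ (ne , bot-⊑ , _)) = ne refl
  V-U-compatible (inj₂ (_ , ⊑-refl , ⊏⇒⊑ (v<u ne))) = ne refl

  Q-V-compatible : ∀ {a b a′ b′ G} → ¬ Clash (Q a b) (V a′ b′) G
  Q-V-compatible (inj₁ (⊑-top , _ , ne)) = ne refl
  Q-V-compatible (inj₁ (⊑-refl , ⊏⇒⊑ () , _))
  Q-V-compatible (inj₁ (⊏⇒⊑ (q<r _) , ⊏⇒⊑ () , _))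
  Q-V-compatible (inj₂ (ne , _ , bot-⊑)) = ne refl
  Q-V-compatible (inj₂ (_ , ⊏⇒⊑ () , ⊑-refl))

  R-V-compatible : ∀ {a b c a′ b′ G} → ¬ Clash (R a b c) (V a′ b′) G
  R-V-compatible (inj₁ (⊑-top , _ , ne)) = ne refl
  R-V-compatible (inj₁ (⊑-refl , ⊏⇒⊑ () , _))
  R-V-compatible (inj₂ (ne , _ , bot-⊑)) = ne refl
  R-V-compatible (inj₂ (_ , ⊏⇒⊑ () , ⊑-refl))

  -- A common lower bound other than `bot` would be a `T` whose first index equals `a` by `t<p` and
  -- differs from `a` by `t<q`. Strictly between `Q a b` and `top` there are only elements
  -- `R a b c`, and these carry a proof of `H a b c`.
  P-Q-clash : ∀ {a b b′ G} → Clash (P a b′) (Q a b) G → ∃[ c ] G ≡ R a b c × H a b c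
  P-Q-clash (inj₁ (_ , ⊑-top , ne)) = contradiction refl ne
  P-Q-clash (inj₁ (⊏⇒⊑ () , ⊑-refl , _))
  P-Q-clash (inj₁ (_ , ⊏⇒⊑ (q<r h) , _)) = _ , refl , h
  P-Q-clash (inj₂ (ne , bot-⊑ , _)) = contradiction refl ne
  P-Q-clash (inj₂ (_ , ⊑-refl , ⊏⇒⊑ ()))
  P-Q-clash (inj₂ (_ , ⊏⇒⊑ t<p , ⊏⇒⊑ (t<q ne))) = contradiction refl ne

  -- Only the complement of a `P` depends on `H`. The hypothesis is confined to that case, so for
  -- any other `E` the lemma applies with an arbitrary `f`.
  complement-compatible : ∀ f E → (∀ {a b} → E ≡ P a b → ∀ c → ¬ H a (f a) c) →
                          ∀ {G} → ¬ Clash E (complement f E) G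
  complement-compatible f top       _  = top-bot-compatible
  complement-compatible f bot       _  = top-bot-compatible ∘ Clash-sym
  complement-compatible f (P a b)   ¬h cl = let c , _ , h = P-Q-clash cl in ¬h refl c h
  complement-compatible f (Q a b)   _  = Q-V-compatible
  complement-compatible f (T a b)   _  = T-Z-compatible
  complement-compatible f (Z a b)   _  = T-Z-compatible ∘ Clash-sym
  complement-compatible f (U a b)   _  = V-U-compatible ∘ Clash-sym
  complement-compatible f (V a b)   _  = V-U-compatible
  complement-compatible f (R a b c) _  = R-V-compatible

  -- A common bound showing that the candidate is no complement of `P a 0`. The function `g` is
  -- consulted for candidates `Q a b` alone.
  obstruction : ℕ → (ℕ → ℕ) → Element → Element
  obstruction a g top        = P a 0
  obstruction a g bot        = P a 0
  obstruction a g (P _ _)    = U 0 0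
  obstruction a g (Q a′ b)   = ifNonZero (equal a′ a) (R a b (g b)) (T a 0)
  obstruction a g (T _ _)    = U 0 0
  -- The successors here and at `V` make the pair of indices differ from that of the candidate, as
  -- `t<z` and `v<u` demand.
  obstruction a g (Z _ b)    = T a (suc b)
  obstruction a g (U a′ b)   = U a′ b
  obstruction a g (V a′ _)   = U (suc a′) 0
  obstruction a g (R _ _ _)  = T a 0

  obstruction-clashes : ∀ a g F → (∀ {b} → F ≡ Q a b → H a b (g b)) →
                        Clash (P a 0) F (obstruction a g F)
  obstruction-clashes a g top _ = inj₂ ((λ ()) , ⊑-refl , ⊑-top)
  obstruction-clashes a g bot _ = inj₁ (⊑-refl , bot-⊑ , λ ())
  obstruction-clashes a g (P _ _) _ = inj₁ (⊏⇒⊑ p<u , ⊏⇒⊑ p<u , λ ())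
  obstruction-clashes a g (Q a′ b) h with equal a′ a | decides-≡ a′ a
  ... | _ | true refl  = inj₁ (⊏⇒⊑ (p<r (h refl)) , ⊏⇒⊑ (q<r (h refl)) , λ ())
  ... | _ | false a′≢a = inj₂ ((λ ()) , ⊏⇒⊑ t<p , ⊏⇒⊑ (t<q (a′≢a ∘ sym)))
  obstruction-clashes a g (T _ _) _ = inj₁ (⊏⇒⊑ p<u , ⊏⇒⊑ t<u , λ ())
  obstruction-clashes a g (Z a′ b) _ = inj₂ ((λ ()) , ⊏⇒⊑ t<p , ⊏⇒⊑ (t<z λ eq → 1+n≢n
    (trans (sym (snd-pair a (suc b))) (trans (cong snd eq) (snd-pair a′ b)))))
  obstruction-clashes a g (U _ _) _ = inj₁ (⊏⇒⊑ p<u , ⊑-refl , λ ())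
  obstruction-clashes a g (V a′ b) _ = inj₁ (⊏⇒⊑ p<u , ⊏⇒⊑ (v<u λ eq → 1+n≢n (sym
    (trans (sym (fst-pair a′ b)) (trans (cong fst eq) (fst-pair (suc a′) 0))))) , λ ())
  obstruction-clashes a g (R _ _ _) _ = inj₂ ((λ ()) , ⊏⇒⊑ t<p , ⊏⇒⊑ t<r)

-- The order as a decidable relation on codes

m≤pair : ∀ m n → m ≤ pair m n
m≤pair m n = m≤n+m m (triangle (m + n))

n≤pair : ∀ m n → n ≤ pair m n
n≤pair m n = ≤-trans (≤-trans (m≤n+m n m) (n≤triangle (m + n))) (m≤m+n _ m)
  where
  n≤triangle : ∀ n → n ≤ triangle n
  n≤triangle zero    = z≤n
  n≤triangle (suc n) = m≤m+n (suc n) (triangle n)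

-- This and the next two bounds let the search for the indices of an edge be a bounded one.
kind<mid : ∀ k a b → k < mid k a b
kind<mid k a b = s≤s (m≤n⇒m≤1+n (m≤pair k _))

index₁<mid : ∀ k a b → a < mid k a b
index₁<mid k a b = s≤s (m≤n⇒m≤1+n (≤-trans (m≤pair a b) (n≤pair k _)))

index₂<mid : ∀ k a b → b < mid k a b
index₂<mid k a b = s≤s (m≤n⇒m≤1+n (≤-trans (n≤pair a b) (n≤pair k _)))

-- One disjunct for each constructor of `_⊏_`, in the same order. Writing the order as a bounded
-- formula lets `χ` provide the program together with its correctness.
edgeFormula : Bounded 7 1
edgeFormula =
     at 2 `∧ to 0 `∧ a `≡ a′
  `∨ at 2 `∧ to 1 `∧ `¬ (a `≡ a′)
  `∨ at 2 `∧ to 3 `∧ `¬ (⟪ a , b ⟫ `≡ ⟪ a′ , b′ ⟫)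
  `∨ at 2 `∧ to 4
  `∨ at 2 `∧ toR
  `∨ at 5 `∧ to 4 `∧ `¬ (⟪ a , b ⟫ `≡ ⟪ a′ , b′ ⟫)
  `∨ at 0 `∧ to 4
  `∨ at 0 `∧ toR `∧ a `≡ a′ `∧ H
  `∨ at 1 `∧ toR `∧ a `≡ a′ `∧ b `≡ b′ `∧ H
  where
  c b′ a′ b a e f : Term 7 1
  c  = var 0F
  b′ = var 1F
  a′ = var 2F
  b  = var 3F
  a  = var 4F
  e  = var 5F
  f  = var 6F

  numeral : ℕ → Term 7 1
  numeral zero    = zero
  numeral (suc k) = suc (numeral k)

  at to : ℕ → Bounded 7 1
  at k = e `≡ suc (suc ⟪ numeral k , ⟪ a , b ⟫ ⟫)
  to k = f `≡ suc (suc ⟪ numeral k , ⟪ a′ , b′ ⟫ ⟫)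

  toR H : Bounded 7 1
  toR = f `≡ suc (suc ⟪ suc (suc (suc (suc (suc (suc c))))) , ⟪ a′ , b′ ⟫ ⟫)
  H   = `¬ (0F · ⟪ a′ , ⟪ b′ , c ⟫ ⟫ `≡ zero)

orderFormula : Bounded 2 1
orderFormula =
     var 1F `≡ zero
  `∨ var 0F `≡ suc zero
  `∨ var 0F `≡ var 1F
  -- `a` and `b` are sought below the first code, and `a′`, `b′` and `c` below the second.
  `∨ (`∃< var 0F ∙ `∃< var 1F ∙ `∃< var 3F ∙ `∃< var 4F ∙ `∃< var 5F ∙ edgeFormula)

abstract
  χ-order : Recursive 1 2
  χ-order = χ orderFormula

  χ-order-decides : ∀ O ns → Decides (⟦ orderFormula ⟧ (tuple ns O)) (apply χ-order O ns)
  χ-order-decides = χ-decides orderFormula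

orderᴿ : Recursive 1 1
orderᴿ = χ-order [ fstᴿ (varᴿ 0F) ∷ˢ sndᴿ (varᴿ 0F) ∷ˢ []ˢ ]

module Coding (h : Baire) where
  open Order (λ a b c → h (pair a (pair b c)) ≢ 0) public

  order : Baire
  order n = apply orderᴿ (h ∷ []) (n ∷ [])

  edge⇒⊏ : ∀ {e f a b a′ b′ c} →
           ⟦ edgeFormula ⟧ (tuple (c ∷ b′ ∷ a′ ∷ b ∷ a ∷ e ∷ f ∷ []) (h ∷ [])) →
           decode e ⊏ decode f
  edge⇒⊏ {a = a} {b} {a′} {b′} {c} = λ where
      (inj₁ (refl , refl , refl)) → transport (T a b) (P a′ b′) t<p
      (inj₂ (inj₁ (refl , refl , ne))) → transport (T a b) (Q a′ b′) (t<q ne)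
      (inj₂ (inj₂ (inj₁ (refl , refl , ne)))) → transport (T a b) (Z a′ b′) (t<z ne)
      (inj₂ (inj₂ (inj₂ (inj₁ (refl , refl))))) → transport (T a b) (U a′ b′) t<u
      (inj₂ (inj₂ (inj₂ (inj₂ (inj₁ (refl , refl)))))) → transport (T a b) (R a′ b′ c) t<r
      (inj₂ (inj₂ (inj₂ (inj₂ (inj₂ (inj₁ (refl , refl , ne))))))) → transport (V a b) (U a′ b′) (v<u ne)
      (inj₂ (inj₂ (inj₂ (inj₂ (inj₂ (inj₂ (inj₁ (refl , refl)))))))) → transport (P a b) (U a′ b′) p<u
      (inj₂ (inj₂ (inj₂ (inj₂ (inj₂ (inj₂ (inj₂ (inj₁ (refl , refl , refl , H))))))))) →
        transport (P a b) (R a′ b′ c) (p<r H)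
      (inj₂ (inj₂ (inj₂ (inj₂ (inj₂ (inj₂ (inj₂ (inj₂ (refl , refl , refl , refl , H))))))))) →
        transport (Q a b) (R a′ b′ c) (q<r H)
    where
    transport : ∀ E F → E ⊏ F → decode (code E) ⊏ decode (code F)
    transport E F = subst₂ _⊏_ (sym (decode-code E)) (sym (decode-code F))

  order⇒⊑ : ∀ {e f} → ⟦ orderFormula ⟧ (tuple (e ∷ f ∷ []) (h ∷ [])) → decode e ⊑ decode f
  order⇒⊑ (inj₁ refl) = ⊑-top
  order⇒⊑ (inj₂ (inj₁ refl)) = bot-⊑
  order⇒⊑ (inj₂ (inj₂ (inj₁ refl))) = ⊑-refl
  order⇒⊑ (inj₂ (inj₂ (inj₂ (_ , _ , _ , _ , _ , _ , _ , _ , _ , _ , edge)))) = ⊏⇒⊑ (edge⇒⊏ edge)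

  ⊏⇒order : ∀ {E F} → E ⊏ F → ⟦ orderFormula ⟧ (tuple (code E ∷ code F ∷ []) (h ∷ []))
  ⊏⇒order = λ where
      -- For an upper end other than an `R`, the bound `s≤s z≤n` fixes `c` as 0.
      (t<p {a} {b} {b′}) → edge 2 0 a b a b′ (s≤s z≤n)
        (inj₁ (refl , refl , refl))
      (t<q {a} {b} {a′} {b′} ne) → edge 2 1 a b a′ b′ (s≤s z≤n)
        (inj₂ (inj₁ (refl , refl , ne)))
      (t<z {a} {b} {a′} {b′} ne) → edge 2 3 a b a′ b′ (s≤s z≤n)
        (inj₂ (inj₂ (inj₁ (refl , refl , ne))))
      (t<u {a} {b} {a′} {b′}) → edge 2 4 a b a′ b′ (s≤s z≤n)
        (inj₂ (inj₂ (inj₂ (inj₁ (refl , refl)))))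
      (t<r {a} {b} {a′} {b′} {c}) → edge 2 (6 + c) a b a′ b′ (c<mid c a′ b′)
        (inj₂ (inj₂ (inj₂ (inj₂ (inj₁ (refl , refl))))))
      (v<u {a} {b} {a′} {b′} ne) → edge 5 4 a b a′ b′ (s≤s z≤n)
        (inj₂ (inj₂ (inj₂ (inj₂ (inj₂ (inj₁ (refl , refl , ne)))))))
      (p<u {a} {b} {a′} {b′}) → edge 0 4 a b a′ b′ (s≤s z≤n)
        (inj₂ (inj₂ (inj₂ (inj₂ (inj₂ (inj₂ (inj₁ (refl , refl))))))))
      (p<r {a} {b} {b′} {c} H) → edge 0 (6 + c) a b′ a b (c<mid c a b)
        (inj₂ (inj₂ (inj₂ (inj₂ (inj₂ (inj₂ (inj₂ (inj₁ (refl , refl , refl , H)))))))))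
      (q<r {a} {b} {c} H) → edge 1 (6 + c) a b a b (c<mid c a b)
        (inj₂ (inj₂ (inj₂ (inj₂ (inj₂ (inj₂ (inj₂ (inj₂ (refl , refl , refl , refl , H)))))))))
    where
    c<mid : ∀ c a b → c < mid (6 + c) a b
    c<mid c a b = ≤-<-trans (m≤n+m c 6) (kind<mid (6 + c) a b)

    edge : ∀ k k′ a b a′ b′ {c} → c < mid k′ a′ b′ →
           ⟦ edgeFormula ⟧ (tuple (c ∷ b′ ∷ a′ ∷ b ∷ a ∷ mid k a b ∷ mid k′ a′ b′ ∷ []) (h ∷ [])) →
           ⟦ orderFormula ⟧ (tuple (mid k a b ∷ mid k′ a′ b′ ∷ []) (h ∷ []))
    edge k k′ a b a′ b′ c< edge = inj₂ (inj₂ (inj₂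
      (_ , index₁<mid k a b , _ , index₂<mid k a b ,
       _ , index₁<mid k′ a′ b′ , _ , index₂<mid k′ a′ b′ , _ , c< , edge)))

  ⊑⇒order : ∀ {E F} → E ⊑ F → ⟦ orderFormula ⟧ (tuple (code E ∷ code F ∷ []) (h ∷ []))
  ⊑⇒order ⊑-top   = inj₁ refl
  ⊑⇒order bot-⊑   = inj₂ (inj₁ refl)
  ⊑⇒order ⊑-refl  = inj₂ (inj₂ (inj₁ refl))
  ⊑⇒order (⊏⇒⊑ l) = ⊏⇒order l

  order-decides : ∀ n → Decides (decode (fst n) ⊑ decode (snd n)) (order n)
  order-decides n = decides-map order⇒⊑
    (subst₂ (λ e f → ⟦ orderFormula ⟧ (tuple (e ∷ f ∷ []) (h ∷ [])))
      (code-decode (fst n)) (code-decode (snd n)) ∘ ⊑⇒order)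
    (χ-order-decides (h ∷ []) (fst n ∷ snd n ∷ []))

  infix 4 _≼_
  _≼_ : ℕ → ℕ → Set
  e ≼ f = order (pair e f) ≡ 1

  ≼-decides : ∀ e f → Decides (decode e ⊑ decode f) (order (pair e f))
  ≼-decides e f = subst₂ (λ e′ f′ → Decides (decode e′ ⊑ decode f′) (order (pair e f)))
    (fst-pair e f) (snd-pair e f) (order-decides (pair e f))

  ≼⇒⊑ : ∀ e f → e ≼ f → decode e ⊑ decode f
  ≼⇒⊑ e f eq with order (pair e f) | ≼-decides e f
  ... | _ | true l = l
  ... | _ | false _  = contradiction eq 0≢1+n

  ⊑⇒≼ : ∀ e f → decode e ⊑ decode f → e ≼ f
  ⊑⇒≼ e f l with order (pair e f) | ≼-decides e f
  ... | _ | true _ = refl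
  ... | _ | false ¬l = contradiction l ¬l

  -- As `code` and `decode` are inverse to each other, the universe is all of ω, and antisymmetry
  -- passes from elements to codes.
  isBoundedPoset : IsBoundedPoset 0 1 (λ _ → 1) order
  isBoundedPoset = record
    { X-characteristic = λ _ → ≤-refl
    ; R-characteristic = characteristic
    ; R⊆X²             = λ _ _ _ → refl , refl
    ; isPartialOrder   = record
      { isPreorder = record
        { isEquivalence = record { refl = refl ; sym = sym ; trans = trans }
        ; reflexive     = λ { {e , _} refl → ⊑⇒≼ e e ⊑-refl }
        ; trans         = λ { {e , _} {f , _} {g , _} l m →
                              ⊑⇒≼ e g (⊑-trans (≼⇒⊑ e f l) (≼⇒⊑ f g m)) }
        }
      ; antisym = λ { {e , _} {f , _} l m →
                      decode-injective (⊑-antisym (≼⇒⊑ e f l) (≼⇒⊑ f e m)) }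
      }
    ; top∈X            = refl
    ; bot∈X            = refl
    ; maximum          = λ { (e , _) → ⊑⇒≼ e 0 ⊑-top }
    ; minimum          = λ { (e , _) → ⊑⇒≼ 1 e bot-⊑ }
    }
    where
    characteristic : ∀ n → order n ≤ 1
    characteristic n with order n | order-decides n
    ... | _ | true _ = ≤-refl
    ... | _ | false _  = z≤n

  poset : Tuple 2 2
  poset = tuple (0 ∷ 1 ∷ []) ((λ _ → 1) ∷ order ∷ [])

  -- The matrix denies a clash: being strictly below `top` or strictly above `bot` means being
  -- different from it.
  compatible⇒matrix : ∀ {e f g} → ¬ Clash (decode e) (decode f) (decode g) →
                      ⟦ complMatrix ⟧ (g ▸ f ▸ e ▸ poset)
  compatible⇒matrix {e} {f} {g} ¬cl _ = refl , λ _ → λ where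
    (inj₁ (l , m , _ , ne)) →
      ¬cl (inj₁ (≼⇒⊑ e g l , ≼⇒⊑ f g m , λ eq → ne (decode-injective eq)))
    (inj₂ ((_ , ne) , l , m)) →
      ¬cl (inj₂ ((λ eq → ne (decode-injective eq)) , ≼⇒⊑ g e l , ≼⇒⊑ g f m))

  matrix⇒compatible : ∀ {e f g} → ⟦ complMatrix ⟧ (g ▸ f ▸ e ▸ poset) →
                      ¬ Clash (decode e) (decode f) (decode g)
  matrix⇒compatible {e} {f} {g} mx (inj₁ (l , m , ne)) = proj₂ (mx refl) refl
    (inj₁ (⊑⇒≼ e g l , ⊑⇒≼ f g m , ⊑⇒≼ g 0 ⊑-top , λ eq → ne (cong decode eq)))
  matrix⇒compatible {e} {f} {g} mx (inj₂ (ne , l , m)) = proj₂ (mx refl) refl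
    (inj₂ ((⊑⇒≼ 1 g bot-⊑ , λ eq → ne (cong decode eq)) , ⊑⇒≼ g e l , ⊑⇒≼ g f m))

-- Programs for complements and obstructions

midᴿ : Recursive q n → Recursive q n → Recursive q n → Recursive q n
midᴿ k a b = sucᴿ (sucᴿ (pairᴿ k (pairᴿ a b)))

kindᴿ index₁ᴿ index₂ᴿ : Recursive q n → Recursive q n
kindᴿ   e = fstᴿ (predᴿ (predᴿ e))
index₁ᴿ e = fstᴿ (sndᴿ (predᴿ (predᴿ e)))
index₂ᴿ e = sndᴿ (sndᴿ (predᴿ (predᴿ e)))

choice∀∃ᴿ choice∃∀ᴿ : Recursive (suc q) n → Recursive (suc q) n
choice∀∃ᴿ a = oracleᴿ 0F (pairᴿ a zeroᴿ)
choice∃∀ᴿ b = oracleᴿ 0F (sucᴿ (pairᴿ b zeroᴿ))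

-- The outer `switch` treats the codes 0 and 1 of `top` and `bot`, the inner one the kinds 0 to 5;
-- its default covers the kinds of `R`.
complementᴿ : Recursive 2 1
complementᴿ = switch e (constᴿ 1 ∷ constᴿ 0 ∷ []) (switch (kindᴿ e)
    ( midᴿ (constᴿ 1) a (choice∀∃ᴿ a)
    ∷ midᴿ (constᴿ 5) zeroᴿ zeroᴿ
    ∷ midᴿ (constᴿ 3) a b
    ∷ midᴿ (constᴿ 2) a b
    ∷ midᴿ (constᴿ 5) a b
    ∷ midᴿ (constᴿ 4) a b
    ∷ [])
    (midᴿ (constᴿ 5) zeroᴿ zeroᴿ))
  where
  e = varᴿ 0F
  a = index₁ᴿ e
  b = index₂ᴿ e

obstructionᴿ : Recursive 2 1
obstructionᴿ = switch e (midᴿ (constᴿ 0) a zeroᴿ ∷ midᴿ (constᴿ 0) a zeroᴿ ∷ [])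
    (switch (kindᴿ e)
    ( midᴿ (constᴿ 4) zeroᴿ zeroᴿ
    ∷ (ifᴿ a′ ≡ᴿ a then midᴿ (constᴿ 6 +ᴿ choice∃∀ᴿ b′) a b′
                   else midᴿ (constᴿ 2) a zeroᴿ)
    ∷ midᴿ (constᴿ 4) zeroᴿ zeroᴿ
    ∷ midᴿ (constᴿ 2) a (sucᴿ b′)
    ∷ midᴿ (constᴿ 4) a′ b′
    ∷ midᴿ (constᴿ 4) (sucᴿ a′) zeroᴿ
    ∷ [])
    (midᴿ (constᴿ 2) a zeroᴿ))
  where
  e  = varᴿ 0F
  -- An `∃∀∃`-witness begins with its value for the outer variable.
  a  = oracleᴿ 0F zeroᴿ
  a′ = index₁ᴿ e
  b′ = index₂ᴿ e

complementCode obstructionCode : Baire → Baire → ℕ → ℕ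
complementCode  α h e = apply complementᴿ (α ∷ h ∷ []) (e ∷ [])
obstructionCode α h e = apply obstructionᴿ (α ∷ h ∷ []) (e ∷ [])

module _ (h : Baire) where
  open Coding h

  decode-complementCode : ∀ α e →
    decode (complementCode α h e) ≡ complement (choice∀∃ α) (decode e)
  decode-complementCode α 0 = refl
  decode-complementCode α 1 = refl
  decode-complementCode α (suc (suc n)) with fst n | fst (snd n) | snd (snd n)
  ... | 0 | a | b = decode-mid 1 a (α (pair a 0))
  ... | 1 | a | b = decode-mid 5 0 0
  ... | 2 | a | b = decode-mid 3 a b
  ... | 3 | a | b = decode-mid 2 a b
  ... | 4 | a | b = decode-mid 5 a b
  ... | 5 | a | b = decode-mid 4 a b
  ... | suc (suc (suc (suc (suc (suc c))))) | a | b = decode-mid 5 0 0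

  decode-obstructionCode : ∀ α e →
    decode (obstructionCode α h e) ≡ obstruction (α 0) (choice∃∀ α) (decode e)
  decode-obstructionCode α 0 = decode-mid 0 (α 0) 0
  decode-obstructionCode α 1 = decode-mid 0 (α 0) 0
  decode-obstructionCode α (suc (suc n)) with fst n | fst (snd n) | snd (snd n)
  ... | 0 | a | b = decode-mid 4 0 0
  -- This is `equal a (α 0)` written out, in the form shared by the program and `obstruction`.
  ... | 1 | a | b with ifNonZero (ifNonZero (a ∸ α 0) 0 1) (ifNonZero (α 0 ∸ a) 0 1) 0
  ...   | zero  = decode-mid 2 (α 0) 0
  ...   | suc _ = decode-mid (6 + choice∃∀ α b) (α 0) b
  decode-obstructionCode α (suc (suc n)) | 2 | a | b = decode-mid 4 0 0
  decode-obstructionCode α (suc (suc n)) | 3 | a | b = decode-mid 2 (α 0) (suc b)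
  decode-obstructionCode α (suc (suc n)) | 4 | a | b = decode-mid 4 a b
  decode-obstructionCode α (suc (suc n)) | 5 | a | b = decode-mid 4 (suc a) 0
  decode-obstructionCode α (suc (suc n)) | suc (suc (suc (suc (suc (suc c))))) | a | b =
    decode-mid 2 (α 0) 0

-- Reduction to complementation in the poset

posetReduction : Reduction zeroMatrix (λ _ → ⊤) complMatrix BoundedPosetCode
posetReduction = record
  { η      = record { numProgs = zero ∷ program (constᴿ {n = 0} 1) ∷ []
                    ; funProgs = program (constᴿ {n = 1} 1) ∷ program orderᴿ ∷ [] }
  ; ∀∃₋    = complementᴿ
  -- A complement of `P a 0` is some `Q a b`, and `b` is its second index.
  ; ∀∃₊    = index₂ᴿ (choice∀∃ᴿ (midᴿ zeroᴿ (varᴿ 0F) zeroᴿ))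
  ; ∃₋     = midᴿ zeroᴿ (oracleᴿ 0F zeroᴿ) zeroᴿ
  ; ∃₊     = index₁ᴿ (oracleᴿ 0F zeroᴿ)
  ; ∃∀₋    = obstructionᴿ
  -- What refutes `Q a b` as a complement is an `R a b c`, whose kind is `6 + c`.
  ; ∃∀₊    = kindᴿ (choice∃∀ᴿ (midᴿ (constᴿ 1) (index₁ᴿ (oracleᴿ 0F zeroᴿ)) (varᴿ 0F)))
               ∸ᴿ constᴿ 6
  ; image  = image
  ; maps   = λ { (tuple [] (h ∷ [])) →
      (zero ∷ run (constᴿ 1) (h ∷ []) [] ∷ []) ,
      ((λ n → run (constᴿ 1) (h ∷ []) (n ∷ [])) ∷ (λ n → run orderᴿ (h ∷ []) (n ∷ [])) ∷ []) }
  ; domain = λ { {tuple [] (h ∷ [])} _ → Coding.isBoundedPoset h }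
  ; ∀∃∀₋   = λ { {tuple [] (h ∷ [])} _ → ∀∃∀₋ h }
  ; ∀∃∀₊   = λ { {tuple [] (h ∷ [])} _ → ∀∃∀₊ h }
  ; ∃∀∃₋   = λ { {tuple [] (h ∷ [])} _ → ∃∀∃₋ h }
  ; ∃∀∃₊   = λ { {tuple [] (h ∷ [])} _ → ∃∀∃₊ h }
  }
  where
  image : Tuple 0 1 → Tuple 2 2
  image (tuple [] (h ∷ [])) = Coding.poset h

  module _ (h : Baire) where
    open Coding h

    ∀∃∀₋ : ∀ α → ∀∃∀-Skolem zeroMatrix (tuple [] (h ∷ [])) (choice∀∃ α) →
           ∀∃∀-Skolem complMatrix poset (complementCode α h)
    ∀∃∀₋ α s e g = compatible⇒matrix {e} {complementCode α h e} {g}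
      (subst (λ F → ¬ Clash (decode e) F (decode g)) (sym (decode-complementCode h α e))
        (complement-compatible (choice∀∃ α) (decode e) λ {a} _ c nz → nz (s a c)))

    -- Suppose the value at `c` is nonzero. With the constant function `c` as `g`, `P a 0` clashes
    -- with its alleged complement `F`, whatever `F` is: if it is a `Q a b`, then `b` is the index
    -- read off, and the supposition supplies `H a b c`.
    ∀∃∀₊ : ∀ α → ∀∃∀-Skolem complMatrix poset (choice∀∃ α) →
           ∀∃∀-Skolem zeroMatrix (tuple [] (h ∷ [])) λ a → index₂ (choice∀∃ α (mid 0 a 0))
    ∀∃∀₊ α s a c = decidable-stable (_ ≟ 0) λ nz →
      let E = code (obstruction a (λ _ → c) F) in
      matrix⇒compatible {mid 0 a 0} {f} {E} (s (mid 0 a 0) E)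
        (subst₂ (λ D → Clash D F) (sym (decode-mid 0 a 0)) (sym (decode-code _))
          (obstruction-clashes a (λ _ → c) F λ {b} eq z → nz
            (subst (λ b → h (pair a (pair b c)) ≡ 0)
              (sym (trans (cong index₂ (code-of {f} eq)) (index₂-mid 1 a b))) z)))
      where
      f = choice∀∃ α (mid 0 a 0)
      F = decode f

    ∃∀∃₋ : ∀ α → ∃∀∃-Skolem (`¬ zeroMatrix) (tuple [] (h ∷ [])) (α 0) (choice∃∀ α) →
           ∃∀∃-Skolem (`¬ complMatrix) poset (mid 0 (α 0) 0) (obstructionCode α h)
    ∃∀∃₋ α s f mx =
      matrix⇒compatible {mid 0 (α 0) 0} {f} {obstructionCode α h f} mx
        (subst₂ (λ D → Clash D (decode f))
          (sym (decode-mid 0 (α 0) 0)) (sym (decode-obstructionCode h α f))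
          (obstruction-clashes (α 0) (choice∃∀ α) (decode f) λ {b} _ → s b))

    -- An element without complement must be a `P`, since all others have one. If it is, the clash
    -- with `Q a₀ b` produces an `R a₀ b c` with a nonzero value at `c`, and `c` is the number read
    -- off from `g`.
    ∃∀∃₊ : ∀ α → ∃∀∃-Skolem (`¬ complMatrix) poset (α 0) (choice∃∀ α) →
           ∃∀∃-Skolem (`¬ zeroMatrix) (tuple [] (h ∷ [])) (index₁ (α 0))
             λ b → kind (choice∃∀ α (mid 1 (index₁ (α 0)) b)) ∸ 6
    ∃∀∃₊ α s b z = s F (compatible⇒matrix {e} {F} {g} λ cl →
      notComplemented λ {a} {b′} eq → impossible {a} {b′} eq cl)
      where
      e = α 0
      a₀ = index₁ e
      F = mid 1 a₀ b
      g = choice∃∀ α F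

      impossible : ∀ {a b′} → decode e ≡ P a b′ → ¬ Clash (decode e) (decode F) (decode g)
      impossible {a} {b′} eq cl
        with refl ← trans (cong index₁ (code-of {e} eq)) (index₁-mid 0 a b′)
        with c , eqR , nz ← P-Q-clash (subst₂ (λ D D′ → Clash D D′ (decode g)) eq (decode-mid 1 a₀ b) cl)
        = nz (subst (λ c → h (pair a₀ (pair b c)) ≡ 0)
               (cong (_∸ 6) (trans (cong kind (code-of {g} eqR)) (kind-mid (6 + c) a₀ b))) z)

      notComplemented : ¬ (∀ {a b′} → decode e ≢ P a b′)
      -- Away from `P` the value of `complement` is independent of its Skolem function, so `α` can
      -- stand in for one.
      notComplemented notP = s f′ (compatible⇒matrix {e} {f′} {g′}
        (subst (λ D → ¬ Clash (decode e) D (decode g′)) (sym (decode-complementCode h α e))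
          (complement-compatible (choice∀∃ α) (decode e) λ eq → contradiction eq notP)))
        where
        f′ = complementCode α h e
        g′ = choice∃∀ α f′

theorem3p15 : Dicomplete (`∀ ∷ `∃ ∷ `∀ ∷ []) Compl
theorem3p15 =
  0 , 1 , ∀∃∀-formula zeroMatrix , zeroMatrix-strictlyDicomplete ,
  Compl-≤dm-zeroMatrix , Reduction⇒≤dm posetReduction
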